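{- Let $m\ge 1$ and $1\le i\le m$. For all sufficiently large positive integers $q$, the number of points $(x_1,\dots,x_m)\in\mathbb{Z}_q^m$ with $x_i=0$ that lie on no hyperplane $H'_q$ with $H'\in\mathcal{B}_m\setminus\{\{x_i=0\}\}$ equals $$(q-2m+1)^{m-i}(q-2m+2)^{i-1}.$$ In other words, the characteristic quasi-polynomial of the restriction $\mathcal{B}_m^{\{x_i=0\}}$ is $|M((\mathcal{B}_m^{\{x_i=0\}})_q)|=(q-2m+1)^{m-i}(q-2m+2)^{i-1}$.
   Context: For $m\ge1$, the Shi arrangement of type B is the set of affine hyperplanes in $\mathbb{R}^m$ $$\mathcal{B}_m=\{\{x_s=0\},\{x_s=1\}\mid s\in[m]\}\cup\{\{x_s\pm x_t=0\},\{x_s\pm x_t=1\}\mid 1\le s<t\le m\},$$ where $[m]=\{1,\dots,m\}$. For a positive integer $q$ and a hyperplane $H=\{a_1x_1+\dots+a_mx_m=b\}$ with integer coefficients, $H_q=\{x\in\mathbb{Z}_q^m : [a_1]_qx_1+\dots+[a_m]_qx_m=[b]_q\}$ is its reduction modulo $q$, with $\mathbb{Z}_q=\mathbb{Z}/q\mathbb{Z}$. For $H\in\mathcal{B}_m$, the restriction is $\mathcal{B}_m^H=\{H\cap H' : H'\in\mathcal{B}_m\setminus\{H\},\ H\cap H'\neq\emptyset\}$, and $|M((\mathcal{B}_m^H)_q)|$ denotes the number of points of $H_q$ not lying on any $H'_q$ with $H'\in\mathcal{B}_m\setminus\{H\}$; this is a quasi-polynomial in $q$ (the characteristic quasi-polynomial).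 -}

module Defs where

open import Data.Nat as ℕ using (ℕ; zero; suc)
open import Data.Integer as ℤ using (ℤ; +_)
open import Data.Integer.Divisibility.Signed using (_∣_; _∣?_)
open import Data.Fin as Fin using (Fin; toℕ; _<_; _≟_)
open import Data.Fin.Properties using (_<?_)
open import Data.Vec as Vec using (Vec; []; _∷_; lookup; tabulate)
open import Data.Vec.Properties using (≡-dec)
open import Data.List as List using (List; []; _∷_; _++_; allFin; concatMap; filter; length)
open import Data.List.Relation.Unary.All using (All; all?)
open import Data.Product using (_×_; _,_; proj₁; proj₂)
open import Data.Product.Properties renaming (≡-dec to ×-≡-dec) using ()
open import Relation.Nullary using (¬_; Dec; yes; no; ¬?)
open import Relation.Binary.PropositionalEquality using (_≡_)

-- An affine hyperplane {a₁x₁+…+aₘxₘ = b} in ℝ^m with integer coefficients,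
-- represented by its coefficient vector and right-hand side.
Hyperplane : ℕ → Set
Hyperplane m = Vec ℤ m × ℤ

_≟H_ : ∀ {m} (H H′ : Hyperplane m) → Dec (H ≡ H′)
_≟H_ = ×-≡-dec (≡-dec ℤ._≟_) ℤ._≟_

e : ∀ {m} → Fin m → Vec ℤ m
e s = tabulate λ k → if-eq k
  where
  if-eq : _ → ℤ
  if-eq k with k ≟ s
  ... | yes _ = + 1
  ... | no  _ = + 0

-- The type-B Shi arrangement 𝓑_m, listed without repetition:
-- {x_s = 0}, {x_s = 1} for s ∈ [m];
-- {x_s ± x_t = 0}, {x_s ± x_t = 1} for s < t.
shiB : (m : ℕ) → List (Hyperplane m)
shiB m =
  concatMap (λ s → (e s , + 0) ∷ (e s , + 1) ∷ []) (allFin m)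
  ++ concatMap (λ s → concatMap (λ t → pairs s t) (filter (λ t → s <? t) (allFin m))) (allFin m)
  where
  pairs : Fin m → Fin m → List (Hyperplane m)
  pairs s t =
    (Vec.zipWith ℤ._+_ (e s) (e t) , + 0) ∷ (Vec.zipWith ℤ._+_ (e s) (e t) , + 1) ∷
    (Vec.zipWith ℤ._-_ (e s) (e t) , + 0) ∷ (Vec.zipWith ℤ._-_ (e s) (e t) , + 1) ∷ []

removeH : ∀ {m} → Hyperplane m → List (Hyperplane m) → List (Hyperplane m)
removeH H = filter (λ H′ → ¬? (H′ ≟H H))

-- points of ℤ_q^m, with ℤ_q represented by Fin q (residues 0,…,q-1)
Point : ℕ → ℕ → Set
Point q m = Vec (Fin q) m

allPoints : (q m : ℕ) → List (Point q m)
allPoints q zero    = [] ∷ []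
allPoints q (suc m) = concatMap (λ a → List.map (a ∷_) (allPoints q m)) (allFin q)

linForm : ∀ {m q} → Vec ℤ m → Point q m → ℤ
linForm []       []       = + 0
linForm (a ∷ as) (x ∷ xs) = a ℤ.* (+ toℕ x) ℤ.+ linForm as xs

-- x ∈ H_q  :⇔  [a₁]x₁+…+[aₘ]xₘ = [b] in ℤ_q  ⇔  q ∣ (a·x − b)
_∈Hq_ : ∀ {m q} → Point q m → Hyperplane m → Set
_∈Hq_ {q = q} x (a , b) = (+ q) ∣ (linForm a x ℤ.- b)

_∈Hq?_ : ∀ {m q} (x : Point q m) (H : Hyperplane m) → Dec (x ∈Hq H)
_∈Hq?_ {q = q} x (a , b) = (+ q) ∣? (linForm a x ℤ.- b)

countRestriction : (m q : ℕ) → Hyperplane m → ℕ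
countRestriction m q H =
  length (filter (λ x → all? (λ H′ → ¬? (x ∈Hq? H′)) (removeH H (shiB m)))
                 (filter (λ x → x ∈Hq? H) (allPoints q m)))

{-# OPTIONS --safe #-}

-- Write |x| for the distance of x from 0 on the cycle ℤ_q. Given x_i = 0, the remaining
-- conditions say exactly that |x_t| ∉ {|x_s|, |x_s − 1|} for all s < t. Up to the residues 0 and 1,
-- the pairs (|x|, |x − 1|) are the oriented edges of the path 1 – … – ⌊q/2⌋ (with a loop at the end
-- for odd q), so choosing x_1 forbids two adjacent vertices to all later coordinates. Merging these
-- two vertices gives the same problem for q − 2 and one coordinate fewer, with the merged vertex
-- forbidden. Summed over the edges, each placement is counted twice for every vertex it leaves
-- free, and once more for the loop; this number depends only on q − 2m. Hence every coordinate
-- contributes a constant factor: q − 2m + 2 before x_i, and q − 2m + 1 after it, where the vertex 1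
-- is forbidden as well and one oriented edge is lost.

module Submission where

open import Defs
open import Data.Bool using (Bool; true; false; if_then_else_; _∨_; _∧_; not)
open import Data.Bool.Properties using (∨-zeroʳ; ∨-identityʳ; ∨-comm; ∨-assoc)
open import Data.Vec using (Vec; []; _∷_; replicate; lookup; zipWith)
open import Data.Product using (_×_; Σ-syntax; ∃; _,_; proj₁; proj₂)
open import Data.Sum using (_⊎_; inj₁; inj₂; [_,_]′)
open import Function using (_∘_; id)
open import Function.Bundles using (_⇔_; Equivalence; mk⇔)
open import Relation.Nullary using (¬_; does; yes; no; contradiction; ¬?)
open import Relation.Nullary.Decidable using (dec-true; dec-false)
open import Relation.Binary.PropositionalEquality

module Placement where

  open import Data.Nat using (ℕ; zero; suc; _+_; _*_; _^_; _∸_; _≤_; _<_; z≤n; s≤s; _≟_)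
  open import Data.Nat.Properties
  open import Data.Nat.Tactic.RingSolver using (solve-∀)
  open import Data.Fin using (Fin; toℕ; zero; suc)

  -- Sums over the vertices 1, ..., n of a path.

  sum₁ : ℕ → (ℕ → ℕ) → ℕ
  sum₁ zero    φ = 0
  sum₁ (suc n) φ = sum₁ n φ + φ (suc n)

  sum₁-cong : ∀ n {φ ψ} → (∀ w → w < n → φ (suc w) ≡ ψ (suc w)) → sum₁ n φ ≡ sum₁ n ψ
  sum₁-cong zero    eq = refl
  sum₁-cong (suc n) eq = cong₂ _+_ (sum₁-cong n λ w w<n → eq w (m<n⇒m<1+n w<n)) (eq n ≤-refl)

  sum₁-const : ∀ n c → sum₁ n (λ _ → c) ≡ n * c
  sum₁-const zero    c = refl
  sum₁-const (suc n) c = trans (cong (_+ c) (sum₁-const n c)) (+-comm (n * c) c)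

  sum₁-+ : ∀ n φ ψ → sum₁ n (λ w → φ w + ψ w) ≡ sum₁ n φ + sum₁ n ψ
  sum₁-+ zero    φ ψ = refl
  sum₁-+ (suc n) φ ψ rewrite sum₁-+ n φ ψ = interchange (sum₁ n φ) (sum₁ n ψ) (φ (suc n)) (ψ (suc n))
    where
    interchange : ∀ a b c d → (a + b) + (c + d) ≡ (a + c) + (b + d)
    interchange = solve-∀

  sum₁-omit : ∀ n φ a → 1 ≤ a → a ≤ n →
    sum₁ n (λ v → if does (a ≟ v) then 0 else φ v) + φ a ≡ sum₁ n φ
  sum₁-omit zero    φ (suc a) _ ()
  sum₁-omit (suc n) φ a 1≤a a≤1+n with a ≟ suc n
  ... | yes refl rewrite dec-true (suc n ≟ suc n) refl =
    cong (_+ φ (suc n)) (trans (+-identityʳ _) (sum₁-cong n below))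
    where
    below : ∀ w → w < n → (if does (suc n ≟ suc w) then 0 else φ (suc w)) ≡ φ (suc w)
    below w w<n = cong (if_then 0 else φ (suc w)) (dec-false (suc n ≟ suc w) λ { refl → <-irrefl refl w<n })
  ... | no a≢1+n rewrite dec-false (a ≟ suc n) a≢1+n =
    trans (rotate (sum₁ n _) (φ (suc n)) (φ a))
          (cong (_+ φ (suc n)) (sum₁-omit n φ a 1≤a (≤-pred (≤∧≢⇒< a≤1+n a≢1+n))))
    where
    rotate : ∀ x y z → (x + y) + z ≡ (x + z) + y
    rotate = solve-∀

  -- Deleting a vanishing term at `v` shifts all later terms down by one. This is how the sum over
  -- edges shrinks when the edge between `v` and `suc v` is contracted.
  sum₁-skip : ∀ n φ φ′ v → 1 ≤ v → v ≤ suc n → φ v ≡ 0 →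
    (∀ w → w < n → suc w < v → φ (suc w) ≡ φ′ (suc w)) →
    (∀ w → w < n → v ≤ suc w → φ (suc (suc w)) ≡ φ′ (suc w)) →
    sum₁ (suc n) φ ≡ sum₁ n φ′
  sum₁-skip n φ φ′ v 1≤v v≤1+n φv below above with m≤n⇒m<n∨m≡n v≤1+n
  ... | inj₂ refl = trans (cong₂ _+_ (sum₁-cong n λ w w<n → below w w<n (s≤s w<n)) φv) (+-identityʳ _)
  sum₁-skip zero    φ φ′ v 1≤v v≤1+n φv below above | inj₁ v<1 =
    contradiction (<-≤-trans v<1 1≤v) (<-irrefl refl)
  sum₁-skip (suc n) φ φ′ v 1≤v v≤1+n φv below above | inj₁ (s≤s v≤1+n′) =
    cong₂ _+_
      (sum₁-skip n φ φ′ v 1≤v v≤1+n′ φv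
        (λ w w<n → below w (m<n⇒m<1+n w<n)) (λ w w<n → above w (m<n⇒m<1+n w<n)))
      (above n ≤-refl v≤1+n′)

  sum₁-head : ∀ n φ → sum₁ (suc n) φ ≡ φ 1 + sum₁ n (φ ∘ suc)
  sum₁-head zero    φ = +-comm 0 (φ 1)
  sum₁-head (suc n) φ = trans (cong (_+ φ (suc (suc n))) (sum₁-head n φ)) (+-assoc (φ 1) _ _)

  sum₁-reverse : ∀ n φ → sum₁ n φ ≡ sum₁ n (λ w → φ (suc n ∸ w))
  sum₁-reverse zero    φ = refl
  sum₁-reverse (suc n) φ = trans (cong (_+ φ (suc n)) (sum₁-reverse n φ))
    (trans (+-comm _ (φ (suc n))) (sym (sum₁-head n λ w → φ (suc (suc n) ∸ w))))

  sum₁-split : ∀ m n φ → sum₁ (m + n) φ ≡ sum₁ m φ + sum₁ n (λ w → φ (m + w))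
  sum₁-split m zero    φ rewrite +-identityʳ m = sym (+-identityʳ _)
  sum₁-split m (suc n) φ rewrite +-suc m n =
    trans (cong (_+ φ (suc (m + n))) (sum₁-split m n φ)) (+-assoc (sum₁ m φ) _ _)

  -- Sets of forbidden values, as Boolean predicates.

  insert : ℕ → (ℕ → Bool) → ℕ → Bool
  insert a A b = does (b ≟ a) ∨ A b

  insert-new : ∀ a A → insert a A a ≡ true
  insert-new a A rewrite dec-true (a ≟ a) refl = refl

  insert-old : ∀ a A {b} → A b ≡ true → insert a A b ≡ true
  insert-old a A {b} Ab rewrite Ab = ∨-zeroʳ (does (b ≟ a))

  insert-other : ∀ {a} A {b} → b ≢ a → insert a A b ≡ A b
  insert-other {a} A {b} b≢a rewrite dec-false (b ≟ a) b≢a = refl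

  insert-absorb : ∀ {a} A b → A a ≡ true → insert a A b ≡ A b
  insert-absorb {a} A b Aa with b ≟ a
  ... | yes refl = trans (insert-new a A) (sym Aa)
  ... | no  b≢a  = insert-other A b≢a

  insert-comm : ∀ a c A b → insert a (insert c A) b ≡ insert c (insert a A) b
  insert-comm a c A b =
    trans (sym (∨-assoc (does (b ≟ a)) _ _))
      (trans (cong (_∨ A b) (∨-comm (does (b ≟ a)) _)) (∨-assoc (does (b ≟ c)) _ _))

  insert-cong : ∀ a {A B : ℕ → Bool} b → A b ≡ B b → insert a A b ≡ insert a B b
  insert-cong a b = cong (does (b ≟ a) ∨_)

  -- Sums over oriented edges, and placements along the path.

  Functional : Set
  Functional = (ℕ → ℕ → ℕ) → ℕ

  -- For q = 2k + odd with k = n + 1, the pairs (|x|, |x − 1|) of the residues x ∉ {0, 1}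
  -- are the oriented edges of the path 1 – 2 – … – k and, for odd q, the loop at k
  -- that comes from x = k + 1.
  edge : (ℕ → ℕ → ℕ) → ℕ → ℕ
  edge F w = F (suc w) w + F w (suc w)

  edgeSum : Bool → ℕ → Functional
  edgeSum odd n F = sum₁ n (edge F) + (if odd then F (suc n) (suc n) else 0)

  edgeSum-cong : ∀ odd n {F F′} → (∀ a f → 1 ≤ a → a ≤ suc n → F a f ≡ F′ a f) →
    edgeSum odd n F ≡ edgeSum odd n F′
  edgeSum-cong odd n {F} {F′} eq = cong₂ _+_ (sum₁-cong n edges) (loop odd)
    where
    edges : ∀ w → w < n → edge F (suc w) ≡ edge F′ (suc w)
    edges w w<n = cong₂ _+_ (eq _ _ (s≤s z≤n) (s≤s w<n)) (eq _ _ (s≤s z≤n) (m<n⇒m<1+n w<n))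
    loop : ∀ o → (if o then F (suc n) (suc n) else 0) ≡ (if o then F′ (suc n) (suc n) else 0)
    loop true  = eq _ _ (s≤s z≤n) ≤-refl
    loop false = refl

  edgeSum-+ : ∀ odd n F F′ → edgeSum odd n (λ a f → F a f + F′ a f) ≡ edgeSum odd n F + edgeSum odd n F′
  edgeSum-+ odd n F F′ =
    trans (cong₂ _+_ (trans (sum₁-cong n λ w _ →
      interchange (F (suc (suc w)) (suc w)) (F′ (suc (suc w)) (suc w))
        (F (suc w) (suc (suc w))) (F′ (suc w) (suc (suc w))))
      (sum₁-+ n (edge F) (edge F′))) (loop odd))
          (interchange (sum₁ n (edge F)) _ _ _)
    where
    interchange : ∀ a b c d → (a + b) + (c + d) ≡ (a + c) + (b + d)
    interchange = solve-∀
    loop : ∀ o → (if o then F (suc n) (suc n) + F′ (suc n) (suc n) else 0)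
      ≡ (if o then F (suc n) (suc n) else 0) + (if o then F′ (suc n) (suc n) else 0)
    loop true  = refl
    loop false = refl

  edgeSum-0 : ∀ odd n → edgeSum odd n (λ _ _ → 0) ≡ 0
  edgeSum-0 odd n = cong₂ _+_ (trans (sum₁-const n 0) (*-zeroʳ n)) (loop odd)
    where
    loop : ∀ o → (if o then 0 else 0) ≡ 0
    loop true  = refl
    loop false = refl

  edgeSum-* : ∀ odd n c F → edgeSum odd n (λ a f → c * F a f) ≡ c * edgeSum odd n F
  edgeSum-* odd n zero    F = edgeSum-0 odd n
  edgeSum-* odd n (suc c) F =
    trans (edgeSum-+ odd n F (λ a f → c * F a f)) (cong (edgeSum odd n F +_) (edgeSum-* odd n c F))

  edgeSum-sum₁ : ∀ odd n m (F : ℕ → ℕ → ℕ → ℕ) →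
    sum₁ m (λ v → edgeSum odd n (F v)) ≡ edgeSum odd n (λ a f → sum₁ m (λ v → F v a f))
  edgeSum-sum₁ odd n zero    F = sym (edgeSum-0 odd n)
  edgeSum-sum₁ odd n (suc m) F =
    trans (cong (_+ edgeSum odd n (F (suc m))) (edgeSum-sum₁ odd n m F))
          (sym (edgeSum-+ odd n (λ a f → sum₁ m (λ v → F v a f)) (F (suc m))))

  -- Counts the ways to choose the coordinates from left to right. S ranges over the pairs
  -- (|x|, |x − 1|) available to one coordinate, A holds the absolute values already forbidden,
  -- and `true` marks the coordinate fixed to 0, whose pair is (0, 1).
  placements : Functional → ∀ {m} → Vec Bool m → (ℕ → Bool) → ℕ
  placements S []           A = 1
  placements S (true  ∷ fs) A = if A 0 then 0 else placements S fs (insert 0 (insert 1 A))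
  placements S (false ∷ fs) A = S λ a f → if A a then 0 else placements S fs (insert a (insert f A))

  if-cong : ∀ {b c} {x y : ℕ} → b ≡ c → (b ≡ false → x ≡ y) → (if b then 0 else x) ≡ (if c then 0 else y)
  if-cong {true}  refl _  = refl
  if-cong {false} refl eq = eq refl

  if-true : ∀ {b} {x : ℕ} → b ≡ true → (if b then 0 else x) ≡ 0
  if-true refl = refl

  -- The recursion tests a set only at `0` and at the vertices up to `suc n`.
  placements-cong : ∀ odd n {m} (fs : Vec Bool m) {A B} → (∀ b → b ≤ suc n → A b ≡ B b) →
    placements (edgeSum odd n) fs A ≡ placements (edgeSum odd n) fs B
  placements-cong odd n []           eq = refl
  placements-cong odd n (true  ∷ fs) {A} {B} eq = if-cong (eq 0 z≤n) λ _ →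
    placements-cong odd n fs λ b b≤ → insert-cong 0 {insert 1 A} {insert 1 B} b (insert-cong 1 {A} {B} b (eq b b≤))
  placements-cong odd n (false ∷ fs) {A} {B} eq = edgeSum-cong odd n λ a f _ a≤ → if-cong (eq a a≤) λ _ →
    placements-cong odd n fs λ b b≤ → insert-cong a {insert f A} {insert f B} b (insert-cong f {A} {B} b (eq b b≤))

  free : ∀ {m} → Vec Bool m → ℕ
  free []           = 0
  free (true  ∷ fs) = free fs
  free (false ∷ fs) = suc (free fs)

  -- Double counting: a placement of r free coordinates occupies r distinct values,
  -- so n + 1 − r values of v remain possible.
  placements-insert : ∀ odd n {m} (fs : Vec Bool m) A →
    sum₁ (suc n) (λ v → placements (edgeSum odd n) fs (insert v A)) + free fs * placements (edgeSum odd n) fs A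
      ≡ suc n * placements (edgeSum odd n) fs A
  placements-insert odd n [] A = trans (+-identityʳ _) (sum₁-const (suc n) 1)
  placements-insert odd n (true ∷ fs) A with A 0 in A0
  ... | true  = trans (cong₂ _+_
    (trans (sum₁-cong (suc n) λ w _ → refl) (sum₁-const (suc n) 0)) (*-zeroʳ (free fs)))
    (+-identityʳ _)
  -- The marked coordinate tests only `0`, which differs from every inserted `suc w`, so it occupies
  -- none of the values being counted.
  ... | false = trans
    (cong (_+ free fs * placements (edgeSum odd n) fs A⁺) (sum₁-cong (suc n) λ w _ →
      placements-cong odd n fs λ b _ → commute (suc w) b))
    (placements-insert odd n fs A⁺)
    where
    A⁺ = insert 0 (insert 1 A)
    commute : ∀ v b → insert 0 (insert 1 (insert v A)) b ≡ insert v A⁺ b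
    commute v b = trans (insert-cong 0 {insert 1 (insert v A)} {insert v (insert 1 A)} b (insert-comm 1 v A b))
                        (insert-comm 0 v (insert 1 A) b)
  placements-insert odd n (false ∷ fs) A = begin
    sum₁ (suc n) (λ v → edgeSum odd n (F (insert v A))) + suc r * edgeSum odd n (F A)
      ≡⟨ cong₂ _+_ (edgeSum-sum₁ odd n (suc n) (λ v → F (insert v A))) (sym (edgeSum-* odd n (suc r) (F A))) ⟩
    edgeSum odd n (λ a f → sum₁ (suc n) (λ v → F (insert v A) a f)) + edgeSum odd n (λ a f → suc r * F A a f)
      ≡⟨ edgeSum-+ odd n (λ a f → sum₁ (suc n) (λ v → F (insert v A) a f)) (λ a f → suc r * F A a f) ⟨
    edgeSum odd n (λ a f → sum₁ (suc n) (λ v → F (insert v A) a f) + suc r * F A a f)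
      ≡⟨ edgeSum-cong odd n pointwise ⟩
    edgeSum odd n (λ a f → suc n * F A a f)
      ≡⟨ edgeSum-* odd n (suc n) (F A) ⟩
    suc n * edgeSum odd n (F A) ∎
    where
    open ≡-Reasoning
    r = free fs
    P = placements (edgeSum odd n) fs
    F : (ℕ → Bool) → ℕ → ℕ → ℕ
    F B a f = if B a then 0 else P (insert a (insert f B))
    pointwise : ∀ a f → 1 ≤ a → a ≤ suc n →
      sum₁ (suc n) (λ v → F (insert v A) a f) + suc r * F A a f ≡ suc n * F A a f
    pointwise a f 1≤a a≤ with A a in Aa
    ... | true  = begin
      sum₁ (suc n) (λ v → if does (a ≟ v) ∨ true then 0 else P (insert a (insert f (insert v A)))) + r * 0
        ≡⟨ cong₂ _+_ (sum₁-cong (suc n) λ w _ → if-true (∨-zeroʳ (does (a ≟ suc w)))) (*-zeroʳ r) ⟩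
      sum₁ (suc n) (λ _ → 0) + 0
        ≡⟨ trans (+-identityʳ _) (sum₁-const (suc n) 0) ⟩
      suc n * 0 ∎
    ... | false = begin
      sum₁ (suc n) (λ v → if does (a ≟ v) ∨ false then 0 else P (insert a (insert f (insert v A))))
        + (P A⁺ + r * P A⁺)
        ≡⟨ cong (_+ (P A⁺ + r * P A⁺)) (sum₁-cong (suc n) λ w _ → if-cong (∨-identityʳ (does (a ≟ suc w)))
             λ _ → placements-cong odd n fs λ b _ → commute (suc w) b) ⟩
      sum₁ (suc n) (λ v → if does (a ≟ v) then 0 else P (insert v A⁺)) + (P A⁺ + r * P A⁺)
        ≡⟨ +-assoc (sum₁ (suc n) (λ v → if does (a ≟ v) then 0 else P (insert v A⁺))) _ _ ⟨
      sum₁ (suc n) (λ v → if does (a ≟ v) then 0 else P (insert v A⁺)) + P A⁺ + r * P A⁺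
        -- The summand `v = a` was lost to the test at `a`. Since `a` already lies in `A⁺`, that
        -- summand would equal `P A⁺`, so one of the `suc r` copies restores it.
        ≡⟨ cong (λ z → sum₁ (suc n) (λ v → if does (a ≟ v) then 0 else P (insert v A⁺)) + z + r * P A⁺)
             (placements-cong odd n fs λ b _ → sym (insert-absorb A⁺ b (insert-new a (insert f A)))) ⟩
      sum₁ (suc n) (λ v → if does (a ≟ v) then 0 else P (insert v A⁺)) + P (insert a A⁺) + r * P A⁺
        ≡⟨ cong (_+ r * P A⁺) (sum₁-omit (suc n) (λ v → P (insert v A⁺)) a 1≤a a≤) ⟩
      sum₁ (suc n) (λ v → P (insert v A⁺)) + r * P A⁺
        ≡⟨ placements-insert odd n fs A⁺ ⟩
      suc n * P A⁺ ∎
      where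
      A⁺ = insert a (insert f A)
      commute : ∀ v b → insert a (insert f (insert v A)) b ≡ insert v A⁺ b
      commute v b = trans (insert-cong a {insert f (insert v A)} {insert v (insert f A)} b (insert-comm f v A b))
                          (insert-comm a v (insert f A) b)

  -- Contraction of two adjacent forbidden vertices.

  skip : ℕ → ℕ → ℕ
  skip v       zero    = zero
  skip zero    (suc b) = suc (suc b)
  skip (suc v) (suc b) = suc (skip v b)

  skip-≤ : ∀ {v b} → b ≤ v → skip v b ≡ b
  skip-≤ z≤n       = refl
  skip-≤ (s≤s b≤v) = cong suc (skip-≤ b≤v)

  skip-> : ∀ {v b} → v < b → skip v b ≡ suc b
  skip-> {zero}  (s≤s _)   = refl
  skip-> {suc v} (s≤s v<b) = cong suc (skip-> v<b)

  skip-injective : ∀ v {b c} → skip v b ≡ skip v c → b ≡ c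
  skip-injective v       {zero}  {zero}  _  = refl
  skip-injective zero    {suc b} {suc c} eq = suc-injective eq
  skip-injective (suc v) {suc b} {suc c} eq = cong suc (skip-injective v (suc-injective eq))
  skip-injective zero    {zero}  {suc c} ()
  skip-injective (suc v) {zero}  {suc c} ()
  skip-injective zero    {suc b} {zero}  ()
  skip-injective (suc v) {suc b} {zero}  ()

  skip-avoids : ∀ v b → skip v b ≢ suc v
  skip-avoids zero    (suc b) ()
  skip-avoids (suc v) (suc b) eq = skip-avoids v b (suc-injective eq)

  -- A′ arises from A when the vertex v + 1 is merged into v.
  Contracts : ℕ → (ℕ → Bool) → (ℕ → Bool) → Set
  Contracts v A A′ = ∀ b → A′ b ≡ A (skip v b)

  contracts-insert : ∀ {v A A′} a → Contracts v A A′ → Contracts v (insert (skip v a) A) (insert a A′)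
  contracts-insert {v} {A} {A′} a eq b with b ≟ a
  ... | yes refl = trans (insert-new b A′) (sym (insert-new (skip v b) A))
  ... | no  b≢a  = trans (insert-other A′ b≢a)
    (trans (eq b) (sym (insert-other A λ same → b≢a (skip-injective v same))))

  contracts-insert-fixed : ∀ {v A A′ a} → a ≤ v → Contracts v A A′ → Contracts v (insert a A) (insert a A′)
  contracts-insert-fixed {v} {A} {A′} {a} a≤v eq =
    subst (λ c → Contracts v (insert c A) (insert a A′)) (skip-≤ a≤v) (contracts-insert {v} {A} {A′} a eq)

  -- `skip v` embeds the short path into the long one with `suc v` as the only vertex missed, so
  -- forbidding `suc v` is invisible on the short path.
  contracts-insert-missed : ∀ {v A A′} → Contracts v A A′ → Contracts v (insert (suc v) A) A′
  contracts-insert-missed {v} {A} eq b = trans (eq b) (sym (insert-other A (skip-avoids v b)))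

  -- A path with two adjacent forbidden vertices v, v + 1 behaves like the path in which
  -- they are merged; this passes from modulus q to q − 2.
  contraction : ∀ odd n v {m} (fs : Vec Bool m) {A A′} → 1 ≤ v → v ≤ suc n →
    A v ≡ true → A (suc v) ≡ true → Contracts v A A′ →
    placements (edgeSum odd (suc n)) fs A ≡ placements (edgeSum odd n) fs A′
  contraction odd n v [] _ _ _ _ _ = refl
  contraction odd n v (true ∷ fs) {A} {A′} 1≤v v≤ Av Asv ctr = if-cong (sym (ctr 0)) λ _ →
    contraction odd n v fs 1≤v v≤
      (insert-old 0 (insert 1 A) (insert-old 1 A Av)) (insert-old 0 (insert 1 A) (insert-old 1 A Asv))
      (contracts-insert-fixed {v} {insert 1 A} {insert 1 A′} z≤n (contracts-insert-fixed {v} {A} {A′} 1≤v ctr))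
  contraction odd n v (false ∷ fs) {A} {A′} 1≤v v≤ Av Asv ctr =
    cong₂ _+_ (sum₁-skip n (edge F) (edge F′) v 1≤v v≤ blocked below above) (loop odd refl)
    where
    F F′ : ℕ → ℕ → ℕ
    F  a f = if A  a then 0 else placements (edgeSum odd (suc n)) fs (insert a (insert f A))
    F′ a f = if A′ a then 0 else placements (edgeSum odd n) fs (insert a (insert f A′))

    A′v : A′ v ≡ true
    A′v = trans (ctr v) (trans (cong A (skip-≤ ≤-refl)) Av)

    -- Both orientations of the contracted edge start at a forbidden vertex.
    blocked : edge F v ≡ 0
    blocked = cong₂ _+_ (if-true Asv) (if-true Av)

    match : ∀ {a f} a′ f′ → skip v a′ ≡ a → Contracts v (insert f A) (insert f′ A′) → F a f ≡ F′ a′ f′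
    match {f = f} a′ f′ refl ctr′ = if-cong (sym (ctr a′)) λ _ →
      contraction odd n v fs 1≤v v≤
        (insert-old (skip v a′) (insert f A) (insert-old f A Av))
        (insert-old (skip v a′) (insert f A) (insert-old f A Asv))
        (contracts-insert {v} {insert f A} {insert f′ A′} a′ ctr′)

    match-skip : ∀ {a f} a′ f′ → skip v a′ ≡ a → skip v f′ ≡ f → F a f ≡ F′ a′ f′
    match-skip a′ f′ a≡ refl = match a′ f′ a≡ (contracts-insert {v} {A} {A′} f′ ctr)

    below : ∀ w → w < n → suc w < v → edge F (suc w) ≡ edge F′ (suc w)
    below w _ w<v = cong₂ _+_
      (match-skip _ _ (skip-≤ w<v) (skip-≤ (<⇒≤ w<v)))
      (match-skip _ _ (skip-≤ (<⇒≤ w<v)) (skip-≤ w<v))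

    above : ∀ w → w < n → v ≤ suc w → edge F (suc (suc w)) ≡ edge F′ (suc w)
    above w _ v≤w with m≤n⇒m<n∨m≡n v≤w
    ... | inj₁ v<w  = cong₂ _+_
      (match-skip _ _ (skip-> (m<n⇒m<1+n v<w)) (skip-> v<w))
      (match-skip _ _ (skip-> v<w) (skip-> (m<n⇒m<1+n v<w)))
    -- This is the edge just above the merged vertex, with `v = suc w`. In the first orientation
    -- `suc v` is replaced by `v` as second entry, and both are forbidden already; the second
    -- orientation is blocked on both paths.
    ... | inj₂ refl = cong₂ _+_
      (match _ _ (skip-> ≤-refl) λ b →
        trans (insert-absorb A′ b A′v) (contracts-insert-missed {v} {A} {A′} ctr b))
      (trans (if-true Asv) (sym (if-true A′v)))

    loop : ∀ o → o ≡ odd →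
      (if o then F (suc (suc n)) (suc (suc n)) else 0) ≡ (if o then F′ (suc n) (suc n) else 0)
    loop false _ = refl
    loop true  _ with m≤n⇒m<n∨m≡n v≤
    ... | inj₁ v<n  = match-skip _ _ (skip-> v<n) (skip-> v<n)
    -- The contraction happens at the end of the path, so the loop sits at a forbidden vertex before
    -- and after.
    ... | inj₂ refl = trans (if-true Asv) (sym (if-true A′v))

  -- The odd counterpart of contraction at the loop: the forbidden end vertex is cut off,
  -- and the edge leading to it becomes the new loop.
  truncation : ∀ n {m} (fs : Vec Bool m) {A A′} →
    A (suc (suc n)) ≡ true → (∀ b → b ≤ suc n → A b ≡ A′ b) →
    placements (edgeSum true (suc n)) fs A ≡ placements (edgeSum true n) fs A′
  truncation n [] _ _ = refl
  truncation n (true ∷ fs) {A} {A′} last eq = if-cong (eq 0 z≤n) λ _ →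
    truncation n fs last λ b b≤ →
      insert-cong 0 {insert 1 A} {insert 1 A′} b (insert-cong 1 {A} {A′} b (eq b b≤))
  truncation n (false ∷ fs) {A} {A′} last eq =
    trans (cong₂ _+_ refl (if-true last)) (trans (+-identityʳ _)
      (cong₂ _+_
        (sum₁-cong n λ w w<n → cong₂ _+_
          (match _ _ (s≤s w<n) λ _ _ → refl)
          (match _ _ (m<n⇒m<1+n w<n) λ _ _ → refl))
        (trans (cong₂ _+_ (if-true last) refl) (match _ _ ≤-refl λ b b≤ → beyond b b≤))))
    where
    F F′ : ℕ → ℕ → ℕ
    F  a f = if A  a then 0 else placements (edgeSum true (suc n)) fs (insert a (insert f A))
    F′ a f = if A′ a then 0 else placements (edgeSum true n) fs (insert a (insert f A′))

    match : ∀ a {f} f′ → a ≤ suc n →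
      (∀ b → b ≤ suc n → insert a (insert f A) b ≡ insert a (insert f′ A) b) → F a f ≡ F′ a f′
    match a {f} f′ a≤ same = if-cong (eq a a≤) λ _ →
      truncation n fs (insert-old a (insert f A) (insert-old f A last)) λ b b≤ →
        trans (same b b≤) (insert-cong a {insert f′ A} {insert f′ A′} b (insert-cong f′ {A} {A′} b (eq b b≤)))

    -- The vertex `suc (suc n)` lies outside the range compared, and inserting `suc n` twice has the
    -- effect of inserting it once; hence the last edge may be replaced by a loop.
    beyond : ∀ b → b ≤ suc n →
      insert (suc n) (insert (suc (suc n)) A) b ≡ insert (suc n) (insert (suc n) A) b
    beyond b b≤ = trans
      (insert-cong (suc n) {insert (suc (suc n)) A} {A} b (insert-other A λ { refl → <-irrefl refl b≤ }))
      (sym (insert-absorb (insert (suc n) A) b (insert-new (suc n) A)))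

  -- Recursion on the first coordinate.

  ∅ origin : ℕ → Bool
  ∅ _ = false
  origin = insert 0 (insert 1 ∅)

  -- `origin` holds the two values forbidden by the coordinate fixed to 0. Both are at most `v`,
  -- hence fixed by `skip v`.
  contracts-origin : ∀ {v} → 1 ≤ v → Contracts v origin origin
  contracts-origin {v} 1≤v =
    contracts-insert-fixed {v} {insert 1 ∅} {insert 1 ∅} z≤n
      (contracts-insert-fixed {v} {∅} {∅} 1≤v λ _ → refl)

  -- The hypothesis `Contracts v A A` says that the background set survives the merge unchanged, as
  -- `∅` and `origin` do. The two orientations of an edge then lead to the same count on the shorter
  -- path, which is the source of the factor 2.
  contraction-up : ∀ odd n {m} (fs : Vec Bool m) {A} v → 1 ≤ v → v ≤ suc n → Contracts v A A →
    placements (edgeSum odd (suc n)) fs (insert (suc v) (insert v A)) ≡ placements (edgeSum odd n) fs (insert v A)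
  contraction-up odd n fs {A} v 1≤v v≤ ctr = contraction odd n v fs 1≤v v≤
    (insert-old (suc v) (insert v A) (insert-new v A)) (insert-new (suc v) (insert v A))
    (contracts-insert-missed {v} {insert v A} {insert v A} (contracts-insert-fixed {v} {A} {A} ≤-refl ctr))

  contraction-down : ∀ odd n {m} (fs : Vec Bool m) {A} v → 1 ≤ v → v ≤ suc n → Contracts v A A →
    placements (edgeSum odd (suc n)) fs (insert v (insert (suc v) A)) ≡ placements (edgeSum odd n) fs (insert v A)
  contraction-down odd n fs {A} v 1≤v v≤ ctr = contraction odd n v fs 1≤v v≤
    (insert-new v (insert (suc v) A)) (insert-old v (insert (suc v) A) (insert-new (suc v) A))
    (contracts-insert-fixed {v} {insert (suc v) A} {A} ≤-refl (contracts-insert-missed {v} {A} {A} ctr))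

  bit : Bool → ℕ
  bit b = if b then 1 else 0

  -- Choosing the loop forbids only the end vertex, and `truncation` cuts that vertex off. What
  -- remains is one count on the shorter path with no new forbidden value.
  loop-term : ∀ odd n {m} (fs : Vec Bool m) A →
    (if odd then placements (edgeSum odd (suc n)) fs (insert (suc (suc n)) (insert (suc (suc n)) A)) else 0)
      ≡ bit odd * placements (edgeSum odd n) fs A
  loop-term false n fs A = refl
  loop-term true  n fs A = trans
    (truncation n fs (insert-new (suc (suc n)) (insert (suc (suc n)) A)) λ b b≤ →
      trans (insert-other (insert (suc (suc n)) A) (λ { refl → <-irrefl refl b≤ }))
            (insert-other A λ { refl → <-irrefl refl b≤ }))
    (sym (*-identityˡ _))

  -- Cancelling `free fs` copies in `placements-insert` leaves a factor that depends only on the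
  -- surplus `e` of the path over the free coordinates.
  sum-insert : ∀ odd e {m} (fs : Vec Bool m) A →
    sum₁ (suc (free fs + e)) (λ v → placements (edgeSum odd (free fs + e)) fs (insert v A))
      ≡ suc e * placements (edgeSum odd (free fs + e)) fs A
  sum-insert odd e fs A = +-cancelʳ-≡ (free fs * X) _ _
    (trans (placements-insert odd (free fs + e) fs A) (split (free fs) e X))
    where
    X = placements (edgeSum odd (free fs + e)) fs A
    split : ∀ r e x → suc (r + e) * x ≡ suc e * x + r * x
    split = solve-∀

  -- Two orientations give `2 * suc e` and the loop gives `bit odd`. Path and coordinates shrink
  -- together, so `e` is the same on both sides.
  placements-∅ : ∀ odd e {m} (fs : Vec Bool m) →
    placements (edgeSum odd (suc (free fs + e))) (false ∷ fs) ∅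
      ≡ (2 * e + bit odd + 2) * placements (edgeSum odd (free fs + e)) fs ∅
  placements-∅ odd e fs = begin
    sum₁ (suc n) (λ w → P′ (insert (suc w) (insert w ∅)) + P′ (insert w (insert (suc w) ∅)))
        + (if odd then P′ (insert (suc (suc n)) (insert (suc (suc n)) ∅)) else 0)
      ≡⟨ cong₂ _+_ (sum₁-cong (suc n) λ w w< → cong₂ _+_
           (contraction-up odd n fs (suc w) (s≤s z≤n) w< λ _ → refl)
           (contraction-down odd n fs (suc w) (s≤s z≤n) w< λ _ → refl))
         (loop-term odd n fs ∅) ⟩
    sum₁ (suc n) (λ w → g w + g w) + bit odd * X
      ≡⟨ cong (_+ bit odd * X) (sum₁-+ (suc n) g g) ⟩
    sum₁ (suc n) g + sum₁ (suc n) g + bit odd * X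
      ≡⟨ cong (λ s → s + s + bit odd * X) (sum-insert odd e fs ∅) ⟩
    suc e * X + suc e * X + bit odd * X
      ≡⟨ collect e (bit odd) X ⟩
    (2 * e + bit odd + 2) * X ∎
    where
    open ≡-Reasoning
    n = free fs + e
    P′ = placements (edgeSum odd (suc n)) fs
    X = placements (edgeSum odd n) fs ∅
    g : ℕ → ℕ
    g w = placements (edgeSum odd n) fs (insert w ∅)
    collect : ∀ e b x → suc e * x + suc e * x + b * x ≡ (2 * e + b + 2) * x
    collect = solve-∀

  -- One choice fewer than in placements-∅: the oriented edge from 1 to 2 is forbidden.
  placements-origin : ∀ odd e {m} (fs : Vec Bool m) →
    placements (edgeSum odd (suc (free fs + e))) (false ∷ fs) origin
      ≡ (2 * e + bit odd + 1) * placements (edgeSum odd (free fs + e)) fs origin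
  placements-origin odd e fs = +-cancelʳ-≡ X _ _ (begin
    sum₁ (suc n) (edge F) + (if odd then P′ (insert (suc (suc n)) (insert (suc (suc n)) origin)) else 0) + X
      ≡⟨ cong (_+ X) (cong₂ _+_ (sum₁-cong (suc n) edges) (loop-term odd n fs origin)) ⟩
    sum₁ (suc n) (λ w → g w + h w) + bit odd * X + X
      ≡⟨ cong (λ s → s + bit odd * X + X) (sum₁-+ (suc n) g h) ⟩
    sum₁ (suc n) g + sum₁ (suc n) h + bit odd * X + X
      ≡⟨ rotate (sum₁ (suc n) g) (sum₁ (suc n) h) (bit odd * X) X ⟩
    sum₁ (suc n) g + (sum₁ (suc n) h + X) + bit odd * X
      -- The vertex 1 already lies in `origin`, so the added `X` equals `g 1`, the term that `h`
      -- omits.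
      ≡⟨ cong (λ x → sum₁ (suc n) g + (sum₁ (suc n) h + x) + bit odd * X)
           (placements-cong odd n fs λ b _ → sym (insert-absorb origin b refl)) ⟩
    sum₁ (suc n) g + (sum₁ (suc n) h + g 1) + bit odd * X
      ≡⟨ cong (λ s → sum₁ (suc n) g + s + bit odd * X) (sum₁-omit (suc n) g 1 ≤-refl (s≤s z≤n)) ⟩
    sum₁ (suc n) g + sum₁ (suc n) g + bit odd * X
      ≡⟨ cong (λ s → s + s + bit odd * X) (sum-insert odd e fs origin) ⟩
    suc e * X + suc e * X + bit odd * X
      ≡⟨ collect e (bit odd) X ⟩
    (2 * e + bit odd + 1) * X + X ∎)
    where
    open ≡-Reasoning
    n = free fs + e
    P′ = placements (edgeSum odd (suc n)) fs
    X = placements (edgeSum odd n) fs origin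
    F : ℕ → ℕ → ℕ
    F a f = if origin a then 0 else P′ (insert a (insert f origin))
    g h : ℕ → ℕ
    g w = placements (edgeSum odd n) fs (insert w origin)
    h w = if does (1 ≟ w) then 0 else g w
    edges : ∀ w → w < suc n → edge F (suc w) ≡ g (suc w) + h (suc w)
    edges w w< = cong₂ _+_ (contraction-up odd n fs (suc w) (s≤s z≤n) w< (contracts-origin (s≤s z≤n))) (down w w<)
      where
      down : ∀ w → w < suc n → F (suc w) (suc (suc w)) ≡ h (suc w)
      down zero    _  = refl
      down (suc w) w< = contraction-down odd n fs (suc (suc w)) (s≤s z≤n) w< (contracts-origin (s≤s z≤n))
    rotate : ∀ a b c d → a + b + c + d ≡ a + (b + d) + c
    rotate = solve-∀
    collect : ∀ e b x → suc e * x + suc e * x + b * x ≡ (2 * e + b + 1) * x + x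
    collect = solve-∀

  -- The closed form for placements on the path.

  schedule : ∀ {r} → Fin (suc r) → Vec Bool (suc r)
  schedule             zero    = true ∷ replicate _ false
  schedule {r = suc r} (suc i) = false ∷ schedule i

  free-replicate : ∀ r → free (replicate r false) ≡ r
  free-replicate zero    = refl
  free-replicate (suc r) = cong suc (free-replicate r)

  free-schedule : ∀ {r} (i : Fin (suc r)) → free (schedule i) ≡ r
  free-schedule             zero    = free-replicate _
  free-schedule {r = suc r} (suc i) = cong suc (free-schedule i)

  placements-replicate : ∀ odd e r →
    placements (edgeSum odd (r + e)) (replicate r false) origin ≡ (2 * e + bit odd + 1) ^ r
  placements-replicate odd e zero    = refl
  placements-replicate odd e (suc r) with placements-origin odd e (replicate r false)
  ... | step rewrite free-replicate r = trans step (cong ((2 * e + bit odd + 1) *_) (placements-replicate odd e r))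

  -- The coordinates before the marked one are handled by `placements-∅`. The marked one turns `∅`
  -- into `origin`, after which `placements-replicate` takes over.
  placements-schedule : ∀ odd e {r} (i : Fin (suc r)) →
    placements (edgeSum odd (r + e)) (schedule i) ∅
      ≡ (2 * e + bit odd + 1) ^ (r ∸ toℕ i) * (2 * e + bit odd + 2) ^ toℕ i
  placements-schedule odd e {r} zero = trans (placements-replicate odd e r) (sym (*-identityʳ _))
  placements-schedule odd e {suc r} (suc i) with placements-∅ odd e (schedule i)
  ... | step rewrite free-schedule i = trans step
    (trans (cong ((2 * e + bit odd + 2) *_) (placements-schedule odd e i))
           (rotate (2 * e + bit odd + 2) ((2 * e + bit odd + 1) ^ (r ∸ toℕ i)) ((2 * e + bit odd + 2) ^ toℕ i)))
    where
    rotate : ∀ c x y → c * (x * y) ≡ x * (c * y)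
    rotate = solve-∀

-- From residues modulo q to oriented edges of the path.

module Residues where

  open Placement
  open import Data.Nat using (ℕ; zero; suc; _+_; _∸_; _≤_; _<_; z≤n; s≤s; _≟_; _⊓_)
  open import Data.Nat.Properties
  open import Data.Nat.ListAction using (sum)
  open import Data.Nat.ListAction.Properties using (sum-++)
  open import Data.Nat.Tactic.RingSolver using (solve-∀)
  open import Data.Fin using (Fin; toℕ; zero; suc)
  open import Data.List using (List; []; _∷_; map; concatMap; allFin; tabulate; filter; length)
  open import Data.List.Properties using (map-cong; map-∘; map-++; map-tabulate)
  open import Relation.Unary using (Decidable)

  -- The distance |x| from 0 on the cycle ℤ_q.
  norm : ℕ → ℕ → ℕ
  norm q x = x ⊓ (q ∸ x)

  prev : ℕ → ℕ → ℕ
  prev q zero    = q ∸ 1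
  prev q (suc x) = x

  norm-low : ∀ {q x} → x + x ≤ q → norm q x ≡ x
  norm-low {q} {x} 2x≤q = m≤n⇒m⊓n≡m (m+n≤o⇒m≤o∸n x 2x≤q)

  norm-high : ∀ {q x w} → x + w ≡ q → w ≤ x → norm q x ≡ w
  norm-high {x = x} {w} refl w≤x = trans (cong (x ⊓_) (m+n∸m≡n x w)) (m≥n⇒m⊓n≡n w≤x)

  -- A second `Functional` besides `edgeSum`, so that one recursion serves both residues and edges.
  -- The residue 0 is listed separately; its pair is `(0, 1)` because `q - 1` has norm 1 for q at
  -- least 2.
  residueSum : ℕ → Functional
  residueSum q F = F 0 1 + sum₁ (q ∸ 1) (λ x → F (norm q x) (norm q (prev q x)))

  -- 2(n + 1) + odd, in a form that exposes two successors.
  modulus : Bool → ℕ → ℕ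
  modulus odd n = suc (suc n + (n + bit odd))

  -- The residues 1, ..., n + 1 climb the path and give the pairs `(suc w, w)`, beginning with
  -- `(1, 0)`. The remaining ones, read downwards from `q - 1`, give the pairs `(w, suc w)` and, for
  -- odd q, finally the loop.
  residueSum-edges : ∀ odd n F → residueSum (modulus odd n) F ≡ F 0 1 + (F 1 0 + edgeSum odd n F)
  residueSum-edges odd n F = cong (F 0 1 +_) (begin
    sum₁ (suc n + b) φ
      ≡⟨ sum₁-split (suc n) b φ ⟩
    sum₁ (suc n) φ + sum₁ b (λ w → φ (suc n + w))
      ≡⟨ cong₂ _+_ low high ⟩
    F 1 0 + sum₁ n (λ w → F (suc w) w) + (sum₁ n (λ w → F w (suc w)) + loop)
      ≡⟨ rotate (F 1 0) (sum₁ n (λ w → F (suc w) w)) _ loop ⟩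
    F 1 0 + (sum₁ n (λ w → F (suc w) w) + sum₁ n (λ w → F w (suc w)) + loop)
      ≡⟨ cong (λ s → F 1 0 + (s + loop)) (sum₁-+ n (λ w → F (suc w) w) (λ w → F w (suc w))) ⟨
    F 1 0 + edgeSum odd n F ∎)
    where
    open ≡-Reasoning
    b = n + bit odd
    q = modulus odd n
    loop = if odd then F (suc n) (suc n) else 0
    φ : ℕ → ℕ
    φ x = F (norm q x) (norm q (prev q x))

    rotate : ∀ a b c d → a + b + (c + d) ≡ a + (b + c + d)
    rotate = solve-∀

    lowBound : ∀ {x} → x ≤ suc n → x + x ≤ q
    lowBound x≤ = ≤-trans (+-mono-≤ x≤ x≤)
      (≤-trans (≤-reflexive (+-suc (suc n) n)) (s≤s (+-monoʳ-≤ (suc n) (m≤m+n n (bit odd)))))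

    low : sum₁ (suc n) φ ≡ F 1 0 + sum₁ n (λ w → F (suc w) w)
    low = trans
      (sum₁-cong (suc n) {φ} {λ x → F x (x ∸ 1)} λ w w< →
        cong₂ F (norm-low (lowBound w<)) (norm-low (lowBound (<⇒≤ w<))))
      (sum₁-head n (λ x → F x (x ∸ 1)))

    position : ∀ {w} → w < b → suc n + (b ∸ w) + suc w ≡ q
    position {w} w<b = begin
      suc n + (b ∸ w) + suc w ≡⟨ +-suc (suc n + (b ∸ w)) w ⟩
      suc (suc n + (b ∸ w) + w) ≡⟨ cong suc (+-assoc (suc n) (b ∸ w) w) ⟩
      suc (suc n + (b ∸ w + w)) ≡⟨ cong (λ z → suc (suc n + z)) (m∸n+n≡m (<⇒≤ w<b)) ⟩
      q ∎

    previous : ∀ {w} → w < b → prev q (suc n + (b ∸ w)) + suc (suc w) ≡ q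
    previous {w} w<b = trans (+-suc (n + (b ∸ w)) (suc w)) (position w<b)

    upper : ∀ w → w < b → w < n → φ (suc n + (b ∸ w)) ≡ F (suc w) (suc (suc w))
    upper w w<b w<n = cong₂ F
      (norm-high (position w<b) (≤-trans (m<n⇒m<1+n w<n) (m≤m+n (suc n) _)))
      (norm-high (previous w<b) (≤-trans (s≤s w<n)
        (≤-trans (≤-reflexive (+-comm 1 n)) (+-monoʳ-≤ n (m<n⇒0<n∸m w<b)))))

    high : sum₁ b (λ w → φ (suc n + w)) ≡ sum₁ n (λ w → F w (suc w)) + loop
    high = trans (sum₁-reverse b (λ w → φ (suc n + w))) (byParity odd refl)
      where
      ψ : ℕ → ℕ
      ψ w = φ (suc n + (suc b ∸ w))
      byParity : ∀ o → o ≡ odd → sum₁ b ψ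
        ≡ sum₁ n (λ w → F w (suc w)) + (if o then F (suc n) (suc n) else 0)
      byParity false refl = trans (cong (λ k → sum₁ k ψ) (+-identityʳ n)) (trans
        (sum₁-cong n λ w w<n → upper w (<-≤-trans w<n (m≤m+n n 0)) w<n) (sym (+-identityʳ _)))
      -- For odd q there is one extra residue, `n + 2`: its norm and that of its predecessor are
      -- both `n + 1`.
      byParity true refl = trans (cong (λ k → sum₁ k ψ) (+-comm n 1)) (cong₂ _+_
        (sum₁-cong n λ w w<n → upper w (<-≤-trans w<n (m≤m+n n 1)) w<n)
        (cong₂ F
          (norm-high (position n<b) (m≤m+n (suc n) _))
          (trans (cong (norm q) previous-middle) (norm-low (lowBound ≤-refl)))))
        where
        n<b : n < n + 1
        n<b = ≤-reflexive (+-comm 1 n)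
        previous-middle : n + (n + 1 ∸ n) ≡ suc n
        previous-middle = trans (cong (n +_) (m+n∸m≡n n 1)) (+-comm n 1)

  -- Forbidden sets only grow, so the marked coordinate, still to come, can no longer take the value
  -- 0.
  placements-blocked : ∀ odd n {r} (i : Fin (suc r)) A → A 0 ≡ true →
    placements (residueSum (modulus odd n)) (schedule i) A ≡ 0
  placements-blocked odd n zero A A0 = if-true A0
  placements-blocked odd n {suc r} (suc i) A A0 = begin
    residueSum (modulus odd n) F ≡⟨ residueSum-edges odd n F ⟩
    F 0 1 + (F 1 0 + edgeSum odd n F)
      ≡⟨ cong₂ _+_ (F≡0 0 1) (cong₂ _+_ (F≡0 1 0) (edgeSum-cong odd n {F} {λ _ _ → 0} λ a f _ _ → F≡0 a f)) ⟩
    edgeSum odd n (λ _ _ → 0) ≡⟨ edgeSum-0 odd n ⟩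
    0 ∎
    where
    open ≡-Reasoning
    F : ℕ → ℕ → ℕ
    F a f = if A a then 0 else placements (residueSum (modulus odd n)) (schedule i) (insert a (insert f A))
    F≡0 : ∀ a f → F a f ≡ 0
    F≡0 a f with A a
    ... | true  = refl
    ... | false = placements-blocked odd n i (insert a (insert f A)) (insert-old a (insert f A) (insert-old f A A0))

  -- The two terms by which `residueSum` exceeds `edgeSum` have first entry 0 or 1, and both are
  -- forbidden here.
  placements-beyond : ∀ odd n {m} (fs : Vec Bool m) A → A 0 ≡ true → A 1 ≡ true →
    placements (residueSum (modulus odd n)) fs A ≡ placements (edgeSum odd n) fs A
  placements-beyond odd n []           A A0 A1 = refl
  placements-beyond odd n (true  ∷ fs) A A0 A1 = trans (if-true A0) (sym (if-true A0))
  placements-beyond odd n (false ∷ fs) A A0 A1 = trans (residueSum-edges odd n F)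
    (trans (cong₂ _+_ (if-true A0) (cong (_+ edgeSum odd n F) (if-true A1)))
      (edgeSum-cong odd n {F} λ a f _ _ → cong (if A a then 0 else_)
        (placements-beyond odd n fs (insert a (insert f A))
          (insert-old a (insert f A) (insert-old f A A0)) (insert-old a (insert f A) (insert-old f A A1)))))
    where
    F : ℕ → ℕ → ℕ
    F a f = if A a then 0 else placements (residueSum (modulus odd n)) fs (insert a (insert f A))

  -- Before the marked coordinate, choosing the residue 0 or 1 forbids the value 0 and so dies later
  -- by `placements-blocked`; after it, `placements-beyond` applies.
  placements-residues : ∀ odd n {r} (i : Fin (suc r)) A →
    placements (residueSum (modulus odd n)) (schedule i) A ≡ placements (edgeSum odd n) (schedule i) A
  placements-residues odd n {r} zero A = cong (if A 0 then 0 else_)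
    (placements-beyond odd n (replicate r false) (insert 0 (insert 1 A)) refl refl)
  placements-residues odd n {suc r} (suc i) A = trans (residueSum-edges odd n F)
    (trans (cong₂ _+_ (F≡0 0 1 refl) (cong (_+ edgeSum odd n F) (F≡0 1 0 refl)))
      (edgeSum-cong odd n {F} λ a f _ _ → cong (if A a then 0 else_)
        (placements-residues odd n i (insert a (insert f A)))))
    where
    F : ℕ → ℕ → ℕ
    F a f = if A a then 0 else placements (residueSum (modulus odd n)) (schedule i) (insert a (insert f A))
    F≡0 : ∀ a f → insert a (insert f A) 0 ≡ true → F a f ≡ 0
    F≡0 a f blocked with A a
    ... | true  = refl
    ... | false = placements-blocked odd n i (insert a (insert f A)) blocked

  -- Counting points by a Boolean test.

  tally : ∀ {X : Set} → (X → Bool) → List X → ℕ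
  tally p xs = sum (map (bit ∘ p) xs)

  tally-guard : ∀ {X : Set} b (p : X → Bool) xs → tally (λ x → not b ∧ p x) xs ≡ (if b then 0 else tally p xs)
  tally-guard false p xs       = refl
  tally-guard true  p []       = refl
  tally-guard true  p (x ∷ xs) = tally-guard true p xs

  tally-map : ∀ {X Y : Set} (g : X → Y) (p : Y → Bool) xs → tally p (map g xs) ≡ tally (p ∘ g) xs
  tally-map g p xs = cong sum (sym (map-∘ xs))

  tally-concatMap : ∀ {X Y : Set} (h : X → List Y) (p : Y → Bool) xs →
    tally p (concatMap h xs) ≡ sum (map (tally p ∘ h) xs)
  tally-concatMap h p []       = refl
  tally-concatMap h p (x ∷ xs) = trans (cong sum (map-++ (bit ∘ p) (h x) (concatMap h xs)))
    (trans (sum-++ (map (bit ∘ p) (h x)) _) (cong (tally p (h x) +_) (tally-concatMap h p xs)))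

  length-filter-filter : ∀ {X : Set} {P Q : X → Set} (P? : Decidable P) (Q? : Decidable Q) (p : X → Bool) →
    (∀ x → p x ≡ true ⇔ (P x × Q x)) → ∀ xs → length (filter P? (filter Q? xs)) ≡ tally p xs
  length-filter-filter P? Q? p equiv []       = refl
  length-filter-filter P? Q? p equiv (x ∷ xs) with Q? x
  ... | no ¬q with p x in px
  ...   | true  = contradiction (proj₂ (Equivalence.to (equiv x) px)) ¬q
  ...   | false = length-filter-filter P? Q? p equiv xs
  length-filter-filter P? Q? p equiv (x ∷ xs) | yes q with P? x
  ... | yes h rewrite Equivalence.from (equiv x) (h , q) = cong suc (length-filter-filter P? Q? p equiv xs)
  ... | no ¬h with p x in px
  ...   | true  = contradiction (proj₁ (Equivalence.to (equiv x) px)) ¬h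
  ...   | false = length-filter-filter P? Q? p equiv xs

  sum-allFin : ∀ n φ → sum (map (φ ∘ toℕ) (allFin (suc n))) ≡ φ 0 + sum₁ n φ
  sum-allFin n φ = trans (cong sum (map-tabulate {n = suc n} id (φ ∘ toℕ))) (cong (φ 0 +_) (tail n φ))
    where
    tail : ∀ n φ → sum (tabulate {n = n} (φ ∘ suc ∘ toℕ)) ≡ sum₁ n φ
    tail zero    φ = refl
    tail (suc n) φ = trans (cong (φ 1 +_) (tail n (φ ∘ suc))) (sym (sum₁-head n φ))

  -- Runs through the coordinates exactly as `placements` does, so that the two can be compared one
  -- coordinate at a time.
  valid : ∀ {q m} → Vec Bool m → (ℕ → Bool) → Point q m → Bool
  valid         []       A []       = true
  valid {q = q} (f ∷ fs) A (x ∷ xs) =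
    (not f ∨ does (toℕ x ≟ 0)) ∧ not (A (norm q (toℕ x)))
      ∧ valid fs (insert (norm q (toℕ x)) (insert (norm q (prev q (toℕ x))) A)) xs

  tally-valid : ∀ q {m} (fs : Vec Bool m) A →
    tally (valid fs A) (allPoints (suc (suc q)) m) ≡ placements (residueSum (suc (suc q))) fs A
  tally-valid q [] A = refl
  tally-valid q {suc m} (f ∷ fs) A = trans
    (tally-concatMap (λ a → map (a ∷_) points) (valid (f ∷ fs) A) (allFin Q))
    (trans (cong sum (map-cong (λ a → tally-map (a ∷_) (valid (f ∷ fs) A) points) (allFin Q))) (byHead f))
    where
    Q = suc (suc q)
    points = allPoints Q m
    F : ℕ → ℕ → ℕ
    F a f = if A a then 0 else placements (residueSum Q) fs (insert a (insert f A))
    rest : ℕ → Point Q m → Bool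
    rest x = valid fs (insert (norm Q x) (insert (norm Q (prev Q x)) A))
    count-rest : ∀ x → tally (λ xs → not (A (norm Q x)) ∧ rest x xs) points ≡ F (norm Q x) (norm Q (prev Q x))
    count-rest x = trans (tally-guard (A (norm Q x)) (rest x) points)
      (cong (if A (norm Q x) then 0 else_) (tally-valid q fs (insert (norm Q x) (insert (norm Q (prev Q x)) A))))
    count-zero : F (norm Q 0) (norm Q (prev Q 0)) ≡ F 0 1
    count-zero = cong (F 0) (norm-high {x = suc q} (+-comm (suc q) 1) (s≤s z≤n))
    byHead : ∀ f → sum (map (λ a → tally (valid (f ∷ fs) A ∘ (a ∷_)) points) (allFin Q))
      ≡ placements (residueSum Q) (f ∷ fs) A
    -- For a marked coordinate every nonzero head fails the test, so only the term of the residue 0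
    -- is left.
    byHead true = trans (sum-allFin (suc q) φ) (trans
      (cong₂ _+_ (trans (count-rest 0) count-zero) (trans
        (sum₁-cong (suc q) λ w _ → tally-guard true (λ xs → not (A (norm Q (suc w))) ∧ rest (suc w) xs) points)
        (trans (sum₁-const (suc q) 0) (*-zeroʳ q))))
      (+-identityʳ _))
      where
      φ : ℕ → ℕ
      φ x = tally (λ xs → does (x ≟ 0) ∧ not (A (norm Q x)) ∧ rest x xs) points
    byHead false = trans (cong sum (map-cong (λ a → count-rest (toℕ a)) (allFin Q)))
      (trans (sum-allFin (suc q) φ) (cong (_+ sum₁ (suc q) φ) count-zero))
      where
      φ : ℕ → ℕ
      φ x = F (norm Q x) (norm Q (prev Q x))

module Hyperplanes where

  open Placement
  open Residues
  open import Data.Nat using (ℕ; zero; suc; _+_; _*_; _^_; _∸_; _<_; z≤n; s≤s; _≟_; _⊓_)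
  open import Data.Nat.Properties
  open import Data.Nat.Divisibility using (>⇒∤; divides)
  open import Data.Nat.Tactic.RingSolver using (solve-∀)
  open import Data.Integer as ℤ using (ℤ; +_)
  import Data.Integer.Properties as ℤ
  open import Data.Integer.Divisibility.Signed
    using (_∣_; ∣⇒∣ᵤ; ∣ᵤ⇒∣; ∣m∣n⇒∣m+n; ∣m+n∣n⇒∣m; ∣m⇒∣-m; ∣-refl)
  import Data.Integer.Tactic.RingSolver as ℤ-Solver
  open import Data.Vec using (tabulate)
  open import Data.Vec.Properties using (lookup∘tabulate; lookup-zipWith; lookup-replicate)
  open import Data.Fin as Fin using (Fin; toℕ; zero; suc)
  open import Data.Fin.Properties using (toℕ<n) renaming (_<?_ to _<F?_; <-cmp to <F-cmp)
  open import Data.List using (List; []; _∷_; concatMap; allFin; filter)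
  open import Data.List.Membership.Propositional using (_∈_; find; lose)
  open import Data.List.Membership.Propositional.Properties
    using (∈-filter⁺; ∈-filter⁻; ∈-++⁺ʳ; ∈-++⁻; ∈-concatMap⁺; ∈-concatMap⁻; ∈-allFin)
  open import Data.List.Relation.Unary.All as All using (All)
  open import Data.List.Relation.Unary.Any using (here; there)
  open import Relation.Binary using (tri<; tri≈; tri>)

  -- Congruences modulo q in terms of the norm.

  ∣⇒≡0 : ∀ {q n} → n < q → + q ∣ + n → n ≡ 0
  ∣⇒≡0 {n = zero}  _   _   = refl
  ∣⇒≡0 {n = suc n} n<q q∣n = contradiction (∣⇒∣ᵤ q∣n) (>⇒∤ n<q)

  -- The sum is less than `2q`, so the quotient can only be 0 or 1.
  ∣+⇒ : ∀ {q x y} → x < q → y < q → + q ∣ + x ℤ.+ + y → (x ≡ 0 × y ≡ 0) ⊎ x + y ≡ q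
  ∣+⇒ {q} {x} {y} x<q y<q q∣ with ∣⇒∣ᵤ q∣
  ... | divides 0 eq = inj₁ (m+n≡0⇒m≡0 x eq , m+n≡0⇒n≡0 x eq)
  ... | divides 1 eq = inj₂ (trans eq (+-identityʳ q))
  ... | divides (suc (suc k)) eq = contradiction
    (subst (_< q + q) eq (+-mono-< x<q y<q)) (≤⇒≯ (+-monoʳ-≤ q (m≤m+n q (k * q))))

  ∣-⇒≡ : ∀ {q x y} → x < q → y < q → + q ∣ + x ℤ.- + y → x ≡ y
  ∣-⇒≡ {q} {x} {y} x<q y<q q∣ = ℤ.+-injective (ℤ.i-j≡0⇒i≡j (+ x) (+ y) (ℤ.∣i∣≡0⇒i≡0
    (∣⇒≡0 small (∣ᵤ⇒∣ (∣⇒∣ᵤ q∣)))))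
    where
    small : ℤ.∣ + x ℤ.- + y ∣ < q
    small = ≤-<-trans
      (≤-trans (≤-reflexive (cong ℤ.∣_∣ (ℤ.[+m]-[+n]≡m⊖n x y))) (ℤ.∣m⊝n∣≤m⊔n x y))
      (⊔-lub x<q y<q)

  norm-≡⇒ : ∀ {q x y} → x < q → y < q → norm q x ≡ norm q y → x ≡ y ⊎ x + y ≡ q
  norm-≡⇒ {q} {x} {y} x<q y<q eq with ⊓-sel x (q ∸ x) | ⊓-sel y (q ∸ y)
  ... | inj₁ l | inj₁ r = inj₁ (trans (sym l) (trans eq r))
  ... | inj₂ l | inj₂ r = inj₁ (∸-cancelˡ-≡ (<⇒≤ x<q) (<⇒≤ y<q) (trans (sym l) (trans eq r)))
  ... | inj₁ l | inj₂ r = inj₂ (trans (cong (_+ y) (trans (sym l) (trans eq r))) (m∸n+n≡m (<⇒≤ y<q)))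
  ... | inj₂ l | inj₁ r = inj₂ (trans (cong (_+_ x) (sym (trans (sym l) (trans eq r)))) (m+[n∸m]≡n (<⇒≤ x<q)))

  norm-opposite : ∀ {q x y} → x + y ≡ q → norm q x ≡ norm q y
  norm-opposite {x = x} {y} refl = trans (cong (x ⊓_) (m+n∸m≡n x y))
    (trans (⊓-comm x y) (cong (y ⊓_) (sym (m+n∸n≡m x y))))

  -- Residues of equal norm agree up to sign. This merges the hyperplanes with `+` and with `-` into
  -- a single condition on norms.
  norm-≡⇔ : ∀ {q x y} → x < q → y < q →
    norm q y ≡ norm q x ⇔ (+ q ∣ + x ℤ.+ + y ⊎ + q ∣ + x ℤ.- + y)
  norm-≡⇔ {q} {x} {y} x<q y<q = mk⇔ to from
    where
    to : norm q y ≡ norm q x → + q ∣ + x ℤ.+ + y ⊎ + q ∣ + x ℤ.- + y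
    to eq with norm-≡⇒ x<q y<q (sym eq)
    ... | inj₁ refl = inj₂ (subst (+ q ∣_) (sym (ℤ.+-inverseʳ (+ x))) (∣ᵤ⇒∣ (divides 0 refl)))
    ... | inj₂ refl = inj₁ ∣-refl
    from : + q ∣ + x ℤ.+ + y ⊎ + q ∣ + x ℤ.- + y → norm q y ≡ norm q x
    from (inj₁ sum) with ∣+⇒ x<q y<q sum
    ... | inj₁ (refl , refl) = refl
    ... | inj₂ opposite      = sym (norm-opposite opposite)
    from (inj₂ difference) = cong (norm q) (sym (∣-⇒≡ x<q y<q difference))

  prev-< : ∀ {q x} → x < q → prev q x < q
  prev-< {suc q} {zero}  _   = ≤-refl
  prev-< {q}     {suc x} x<q = <⇒≤ x<q

  -- Absorbs the constant 1 into `x`, so that the hyperplanes with right-hand side 1 become ones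
  -- with right-hand side 0; `z` stands for `y` or its negative.
  prev-∣⇔ : ∀ {q x} z → x < q → + q ∣ + x ℤ.+ z ℤ.- + 1 ⇔ + q ∣ + prev q x ℤ.+ z
  prev-∣⇔ {q} {suc x} z _ = mk⇔ (subst (+ q ∣_) (cancel (+ x) z)) (subst (+ q ∣_) (sym (cancel (+ x) z)))
    where
    cancel : ∀ x z → + 1 ℤ.+ x ℤ.+ z ℤ.- + 1 ≡ x ℤ.+ z
    cancel = ℤ-Solver.solve-∀
  -- At residue 0 the predecessor is the modulus minus 1, which differs from -1 by one modulus.
  prev-∣⇔ {suc q} {zero} z _ = mk⇔
    (λ d → ∣m+n∣n⇒∣m {n = ℤ.- + suc q} (subst (+ suc q ∣_) (wrap (+ q) z) d) (∣m⇒∣-m ∣-refl))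
    (λ d → subst (+ suc q ∣_) (sym (wrap (+ q) z)) (∣m∣n⇒∣m+n d (∣m⇒∣-m ∣-refl)))
    where
    wrap : ∀ q z → + 0 ℤ.+ z ℤ.- + 1 ≡ q ℤ.+ z ℤ.+ ℤ.- (+ 1 ℤ.+ q)
    wrap = ℤ-Solver.solve-∀

  Separated : ℕ → ℕ → ℕ → Set
  Separated q x y = norm q y ≢ norm q x × norm q y ≢ norm q (prev q x)

  Apart : ℕ → ℕ → ℕ → Set
  Apart q x y =
    ¬ (+ q ∣ + x ℤ.+ + y ℤ.- + 0) × ¬ (+ q ∣ + x ℤ.+ + y ℤ.- + 1) ×
    ¬ (+ q ∣ + x ℤ.- + y ℤ.- + 0) × ¬ (+ q ∣ + x ℤ.- + y ℤ.- + 1)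

  separated⇔apart : ∀ {q x y} → x < q → y < q → Separated q x y ⇔ Apart q x y
  separated⇔apart {q} {x} {y} x<q y<q = mk⇔
    (λ { (≢x , ≢p) →
        (λ d → ≢x (from same (inj₁ (drop0 d))))
      , (λ d → ≢p (from shifted (inj₁ (to (prev-∣⇔ (+ y) x<q) d))))
      , (λ d → ≢x (from same (inj₂ (drop0 d))))
      , (λ d → ≢p (from shifted (inj₂ (to (prev-∣⇔ (ℤ.- + y) x<q) d)))) })
    (λ { (s0 , s1 , d0 , d1) →
        (λ eq → [ s0 ∘ add0 , d0 ∘ add0 ]′ (to same eq))
      , (λ eq → [ s1 ∘ from (prev-∣⇔ (+ y) x<q) , d1 ∘ from (prev-∣⇔ (ℤ.- + y) x<q) ]′ (to shifted eq)) })
    where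
    open Equivalence
    same    = norm-≡⇔ x<q y<q
    shifted = norm-≡⇔ (prev-< x<q) y<q
    drop0 : ∀ {z} → + q ∣ z ℤ.- + 0 → + q ∣ z
    drop0 {z} = subst (+ q ∣_) (ℤ.+-identityʳ z)
    add0 : ∀ {z} → + q ∣ z → + q ∣ z ℤ.- + 0
    add0 {z} = subst (+ q ∣_) (sym (ℤ.+-identityʳ z))

  -- The meaning of the Boolean test.

  ∧-true⁻ : ∀ {a b} → a ∧ b ≡ true → a ≡ true × b ≡ true
  ∧-true⁻ {true} eq = refl , eq

  not-true⁻ : ∀ {a} → not a ≡ true → a ≡ false
  not-true⁻ {false} _ = refl

  insert-false⁻ : ∀ a A {b} → insert a A b ≡ false → b ≢ a × A b ≡ false
  insert-false⁻ a A {b} eq with b ≟ a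
  ... | yes refl = contradiction (trans (sym eq) (insert-new a A)) λ ()
  ... | no  b≢a  = b≢a , trans (sym (insert-other A b≢a)) eq

  insert-false⁺ : ∀ a A {b} → b ≢ a → A b ≡ false → insert a A b ≡ false
  insert-false⁺ a A b≢a Ab = trans (insert-other A b≢a) Ab

  coord : ∀ {q m} → Point q m → Fin m → ℕ
  coord x s = toℕ (lookup x s)

  Valid : ∀ {q m} → Vec Bool m → (ℕ → Bool) → Point q m → Set
  Valid {q} fs A x =
    (∀ s → A (norm q (coord x s)) ≡ false) ×
    (∀ s → lookup fs s ≡ true → coord x s ≡ 0) ×
    (∀ s t → s Fin.< t → Separated q (coord x s) (coord x t))

  valid-sound : ∀ {q m} (fs : Vec Bool m) A (x : Point q m) → valid fs A x ≡ true → Valid fs A x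
  valid-sound [] A [] _ = (λ ()) , (λ ()) , (λ ())
  valid-sound {q} (f ∷ fs) A (x ∷ xs) eq with ∧-true⁻ eq
  ... | at0 , eq′ with ∧-true⁻ eq′
  ... | Ax , eq″ with valid-sound fs _ xs eq″
  ... | avoid , pinned , sep = avoid⁺ , pinned⁺ at0 , sep⁺
    where
    a = norm q (toℕ x)
    p = norm q (prev q (toℕ x))
    old : ∀ s → norm q (coord xs s) ≢ a × insert p A (norm q (coord xs s)) ≡ false
    old s = insert-false⁻ a (insert p A) (avoid s)
    avoid⁺ : ∀ s → A (norm q (coord (x ∷ xs) s)) ≡ false
    avoid⁺ zero    = not-true⁻ Ax
    avoid⁺ (suc s) = proj₂ (insert-false⁻ p A (proj₂ (old s)))
    is-zero : ∀ {n} → does (n ≟ 0) ≡ true → n ≡ 0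
    is-zero {zero} _ = refl
    pinned⁺ : ∀ {f} → not f ∨ does (toℕ x ≟ 0) ≡ true →
      ∀ s → lookup (f ∷ fs) s ≡ true → coord (x ∷ xs) s ≡ 0
    pinned⁺ at0 zero refl = is-zero at0
    pinned⁺ at0 (suc s) fss = pinned s fss
    sep⁺ : ∀ s t → s Fin.< t → Separated q (coord (x ∷ xs) s) (coord (x ∷ xs) t)
    sep⁺ zero    (suc t) _         = proj₁ (old t) , proj₁ (insert-false⁻ p A (proj₂ (old t)))
    sep⁺ (suc s) (suc t) (s≤s s<t) = sep s t s<t

  valid-complete : ∀ {q m} (fs : Vec Bool m) A (x : Point q m) → Valid fs A x → valid fs A x ≡ true
  valid-complete [] A [] _ = refl
  valid-complete {q} (f ∷ fs) A (x ∷ xs) (avoid , pinned , sep) =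
    cong₂ _∧_ (at0 f (pinned zero)) (cong₂ _∧_ (cong not (avoid zero))
      (valid-complete fs _ xs
        ( (λ s → insert-false⁺ a (insert p A) (proj₁ (sep zero (suc s) (s≤s z≤n)))
                   (insert-false⁺ p A (proj₂ (sep zero (suc s) (s≤s z≤n))) (avoid (suc s))))
        , (λ s → pinned (suc s))
        , (λ s t s<t → sep (suc s) (suc t) (s≤s s<t)))))
    where
    a = norm q (toℕ x)
    p = norm q (prev q (toℕ x))
    at0 : ∀ f → (f ≡ true → toℕ x ≡ 0) → not f ∨ does (toℕ x ≟ 0) ≡ true
    at0 false _  = refl
    at0 true  eq = dec-true (toℕ x ≟ 0) (eq refl)

  lookup-schedule : ∀ {r} (i : Fin (suc r)) → lookup (schedule i) i ≡ true
  lookup-schedule             zero    = refl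
  lookup-schedule {r = suc r} (suc i) = lookup-schedule i

  lookup-schedule⁻ : ∀ {r} (i s : Fin (suc r)) → lookup (schedule i) s ≡ true → s ≡ i
  lookup-schedule⁻             zero    zero    _  = refl
  lookup-schedule⁻             zero    (suc s) eq = contradiction (trans (sym eq) (lookup-replicate s false)) λ ()
  lookup-schedule⁻ {r = suc r} (suc i) (suc s) eq = cong suc (lookup-schedule⁻ i s eq)

  -- Gives access to the function local to the definition of e.
  e-tabulated : ∀ {m} (s : Fin m) → Σ[ f ∈ (Fin m → ℤ) ] e s ≡ tabulate f
  e-tabulated s = _ , refl

  lookup-e : ∀ {m} (s k : Fin m) → lookup (e s) k ≡ (if does (k Fin.≟ s) then + 1 else + 0)
  lookup-e s k = trans (lookup∘tabulate (proj₁ (e-tabulated s)) k) entry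
    where
    entry : proj₁ (e-tabulated s) k ≡ (if does (k Fin.≟ s) then + 1 else + 0)
    entry with k Fin.≟ s
    ... | yes _ = refl
    ... | no  _ = refl

  lookup-e-same : ∀ {m} (s : Fin m) → lookup (e s) s ≡ + 1
  lookup-e-same s = trans (lookup-e s s) (cong (if_then + 1 else + 0) (dec-true (s Fin.≟ s) refl))

  lookup-e-other : ∀ {m} {s k : Fin m} → k ≢ s → lookup (e s) k ≡ + 0
  lookup-e-other {s = s} {k} k≢s = trans (lookup-e s k) (cong (if_then + 1 else + 0) (dec-false (k Fin.≟ s) k≢s))

  -- Values of the linear forms at points.

  linForm-zero : ∀ {q m} (a : Vec ℤ m) (x : Point q m) → (∀ k → lookup a k ≡ + 0) → linForm a x ≡ + 0
  linForm-zero []      []       _  = refl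
  linForm-zero (a ∷ as) (x ∷ xs) eq rewrite eq zero | linForm-zero as xs (eq ∘ suc) = refl

  linForm-unit : ∀ {q m} (a : Vec ℤ m) (x : Point q m) s →
    lookup a s ≡ + 1 → (∀ k → k ≢ s → lookup a k ≡ + 0) → linForm a x ≡ + coord x s
  linForm-unit (a ∷ as) (x ∷ xs) zero    one others
    rewrite one | linForm-zero as xs (λ k → others (suc k) λ ()) =
    trans (ℤ.+-identityʳ _) (ℤ.*-identityˡ (+ toℕ x))
  linForm-unit (a ∷ as) (x ∷ xs) (suc s) one others
    rewrite others zero (λ ()) = trans (ℤ.+-identityˡ _)
      (linForm-unit as xs s one λ k k≢s → others (suc k) λ { refl → k≢s refl })

  linForm-e : ∀ {q m} (x : Point q m) s → linForm (e s) x ≡ + coord x s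
  linForm-e x s = linForm-unit (e s) x s (lookup-e-same s) λ k → lookup-e-other

  linForm-plus : ∀ {q m} (a b : Vec ℤ m) (x : Point q m) →
    linForm (zipWith ℤ._+_ a b) x ≡ linForm a x ℤ.+ linForm b x
  linForm-plus []       []       []       = refl
  linForm-plus (a ∷ as) (b ∷ bs) (x ∷ xs) rewrite linForm-plus as bs xs =
    distribute a b (+ toℕ x) (linForm as xs) (linForm bs xs)
    where
    distribute : ∀ a b x u v → (a ℤ.+ b) ℤ.* x ℤ.+ (u ℤ.+ v) ≡ (a ℤ.* x ℤ.+ u) ℤ.+ (b ℤ.* x ℤ.+ v)
    distribute = ℤ-Solver.solve-∀

  linForm-minus : ∀ {q m} (a b : Vec ℤ m) (x : Point q m) →
    linForm (zipWith ℤ._-_ a b) x ≡ linForm a x ℤ.- linForm b x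
  linForm-minus []       []       []       = refl
  linForm-minus (a ∷ as) (b ∷ bs) (x ∷ xs) rewrite linForm-minus as bs xs =
    distribute a b (+ toℕ x) (linForm as xs) (linForm bs xs)
    where
    distribute : ∀ a b x u v → (a ℤ.- b) ℤ.* x ℤ.+ (u ℤ.- v) ≡ (a ℤ.* x ℤ.+ u) ℤ.- (b ℤ.* x ℤ.+ v)
    distribute = ℤ-Solver.solve-∀

  linForm-e+e : ∀ {q m} (x : Point q m) s t →
    linForm (zipWith ℤ._+_ (e s) (e t)) x ≡ + coord x s ℤ.+ + coord x t
  linForm-e+e x s t = trans (linForm-plus (e s) (e t) x) (cong₂ ℤ._+_ (linForm-e x s) (linForm-e x t))

  linForm-e-e : ∀ {q m} (x : Point q m) s t →
    linForm (zipWith ℤ._-_ (e s) (e t)) x ≡ + coord x s ℤ.- + coord x t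
  linForm-e-e x s t = trans (linForm-minus (e s) (e t) x) (cong₂ ℤ._-_ (linForm-e x s) (linForm-e x t))

  -- The combined vector is nonzero at both `s` and `t`, while `e i` vanishes at whichever of the
  -- two differs from `i`.
  pair-vector-≢ : ∀ {m} (_⊕_ : ℤ → ℤ → ℤ) → (+ 1) ⊕ (+ 0) ≢ + 0 → (+ 0) ⊕ (+ 1) ≢ + 0 →
    ∀ {s t : Fin m} i {b} → s Fin.< t → (zipWith _⊕_ (e s) (e t) , b) ≢ (e i , + 0)
  pair-vector-≢ _⊕_ 1⊕0 0⊕1 {s} {t} i s<t eq with s Fin.≟ i
  ... | no s≢i = 1⊕0 (begin
    (+ 1) ⊕ (+ 0) ≡⟨ cong₂ _⊕_ (lookup-e-same s) (lookup-e-other s≢t) ⟨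
    lookup (e s) s ⊕ lookup (e t) s ≡⟨ lookup-zipWith _⊕_ s (e s) (e t) ⟨
    lookup (zipWith _⊕_ (e s) (e t)) s ≡⟨ cong (λ H → lookup (proj₁ H) s) eq ⟩
    lookup (e i) s ≡⟨ lookup-e-other s≢i ⟩
    + 0 ∎)
    where
    open ≡-Reasoning
    s≢t : s ≢ t
    s≢t refl = <-irrefl refl s<t
  ... | yes refl = 0⊕1 (begin
    (+ 0) ⊕ (+ 1) ≡⟨ cong₂ _⊕_ (lookup-e-other t≢s) (lookup-e-same t) ⟨
    lookup (e s) t ⊕ lookup (e t) t ≡⟨ lookup-zipWith _⊕_ t (e s) (e t) ⟨
    lookup (zipWith _⊕_ (e s) (e t)) t ≡⟨ cong (λ H → lookup (proj₁ H) t) eq ⟩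
    lookup (e s) t ≡⟨ lookup-e-other t≢s ⟩
    + 0 ∎)
    where
    open ≡-Reasoning
    t≢s : t ≢ s
    t≢s refl = <-irrefl refl s<t

  -- A global copy of the list `pairs` that is local to `shiB`.
  pairH : ∀ {m} → Fin m → Fin m → List (Hyperplane m)
  pairH s t =
    (zipWith ℤ._+_ (e s) (e t) , + 0) ∷ (zipWith ℤ._+_ (e s) (e t) , + 1) ∷
    (zipWith ℤ._-_ (e s) (e t) , + 0) ∷ (zipWith ℤ._-_ (e s) (e t) , + 1) ∷ []

  pair-∈ : ∀ {m} {s t : Fin m} {H} → s Fin.< t → H ∈ pairH s t → H ∈ shiB m
  pair-∈ {m} {s} {t} s<t H∈ = ∈-++⁺ʳ (concatMap (λ s → (e s , + 0) ∷ (e s , + 1) ∷ []) (allFin m))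
    (∈-concatMap⁺ _ (lose (∈-allFin s) (∈-concatMap⁺ _ (lose (∈-filter⁺ (s <F?_) (∈-allFin t) s<t) H∈))))

  apart⇒∉ : ∀ {q m} {x : Point q m} {s t H} → Apart q (coord x s) (coord x t) → H ∈ pairH s t → ¬ (x ∈Hq H)
  apart⇒∉ {q} {x = x} {s} {t} (s0 , s1 , d0 , d1) = λ
    { (here refl) → s0 ∘ rewriteSum (+ 0)
    ; (there (here refl)) → s1 ∘ rewriteSum (+ 1)
    ; (there (there (here refl))) → d0 ∘ rewriteDifference (+ 0)
    ; (there (there (there (here refl)))) → d1 ∘ rewriteDifference (+ 1) }
    where
    rewriteSum : ∀ b → + q ∣ linForm (zipWith ℤ._+_ (e s) (e t)) x ℤ.- b →
      + q ∣ + coord x s ℤ.+ + coord x t ℤ.- b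
    rewriteSum b = subst (λ z → + q ∣ z ℤ.- b) (linForm-e+e x s t)
    rewriteDifference : ∀ b → + q ∣ linForm (zipWith ℤ._-_ (e s) (e t)) x ℤ.- b →
      + q ∣ + coord x s ℤ.- + coord x t ℤ.- b
    rewriteDifference b = subst (λ z → + q ∣ z ℤ.- b) (linForm-e-e x s t)

  ∉⇒apart : ∀ {q m} {x : Point q m} {s t} → (∀ {H} → H ∈ pairH s t → ¬ (x ∈Hq H)) →
    Apart q (coord x s) (coord x t)
  ∉⇒apart {q} {x = x} {s} {t} avoid =
      avoid (here refl) ∘ rewriteSum (+ 0)
    , avoid (there (here refl)) ∘ rewriteSum (+ 1)
    , avoid (there (there (here refl))) ∘ rewriteDifference (+ 0)
    , avoid (there (there (there (here refl)))) ∘ rewriteDifference (+ 1)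
    where
    rewriteSum : ∀ b → + q ∣ + coord x s ℤ.+ + coord x t ℤ.- b →
      + q ∣ linForm (zipWith ℤ._+_ (e s) (e t)) x ℤ.- b
    rewriteSum b = subst (λ z → + q ∣ z ℤ.- b) (sym (linForm-e+e x s t))
    rewriteDifference : ∀ b → + q ∣ + coord x s ℤ.- + coord x t ℤ.- b →
      + q ∣ linForm (zipWith ℤ._-_ (e s) (e t)) x ℤ.- b
    rewriteDifference b = subst (λ z → + q ∣ z ℤ.- b) (sym (linForm-e-e x s t))

  -- The Boolean test describes the points of the restriction.

  Restricted : ∀ {q m} → Fin m → Point q m → Set
  Restricted {m = m} i x = All (λ H → ¬ (x ∈Hq H)) (removeH (e i , + 0) (shiB m)) × x ∈Hq (e i , + 0)

  -- Separation takes care of the hyperplanes with two coordinates. Those with a single coordinate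
  -- `s` other than `i` reduce to the pair of `s` and `i`, because coordinate `i` is 0.
  valid⇒restricted : ∀ {q r} (i : Fin (suc r)) (x : Point (suc (suc q)) (suc r)) →
    valid (schedule i) ∅ x ≡ true → Restricted i x
  valid⇒restricted {q} {r} i x ok with valid-sound (schedule i) ∅ x ok
  ... | _ , pinned , sep = All.tabulate avoid ,
    subst (λ z → + Q ∣ z ℤ.- + 0) (sym (trans (linForm-e x i) (cong +_ xi≡0))) (∣ᵤ⇒∣ (divides 0 refl))
    where
    Q = suc (suc q)
    xi≡0 : coord x i ≡ 0
    xi≡0 = pinned i (lookup-schedule i)
    apart : ∀ {s t} → s Fin.< t → Apart Q (coord x s) (coord x t)
    apart {s} {t} s<t = Equivalence.to (separated⇔apart (toℕ<n _) (toℕ<n _)) (sep s t s<t)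
    other : ∀ {s} → s ≢ i → ¬ (+ Q ∣ + coord x s ℤ.- + 0) × ¬ (+ Q ∣ + coord x s ℤ.- + 1)
    other {s} s≢i with <F-cmp s i
    ... | tri≈ _ s≡i _ = contradiction s≡i s≢i
    ... | tri< s<i _ _ = add-zero (+ 0) (proj₁ (apart s<i)) , add-zero (+ 1) (proj₁ (proj₂ (apart s<i)))
      where
      add-zero : ∀ b → ¬ (+ Q ∣ + coord x s ℤ.+ + coord x i ℤ.- b) → ¬ (+ Q ∣ + coord x s ℤ.- b)
      add-zero b = subst (λ z → ¬ (+ Q ∣ z ℤ.- b))
        (trans (cong (λ z → + coord x s ℤ.+ + z) xi≡0) (ℤ.+-identityʳ (+ coord x s)))
    ... | tri> _ _ i<s = zero-add (+ 0) (proj₁ (apart i<s)) , zero-add (+ 1) (proj₁ (proj₂ (apart i<s)))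
      where
      zero-add : ∀ b → ¬ (+ Q ∣ + coord x i ℤ.+ + coord x s ℤ.- b) → ¬ (+ Q ∣ + coord x s ℤ.- b)
      zero-add b = subst (λ z → ¬ (+ Q ∣ + z ℤ.+ + coord x s ℤ.- b)) xi≡0
    single : ∀ s {H} → H ∈ (e s , + 0) ∷ (e s , + 1) ∷ [] → H ≢ (e i , + 0) → ¬ (x ∈Hq H)
    single s (here refl) ≢i with s Fin.≟ i
    ... | yes refl = contradiction refl ≢i
    ... | no s≢i = proj₁ (other s≢i) ∘ subst (λ z → + Q ∣ z ℤ.- + 0) (linForm-e x s)
    single s (there (here refl)) _ with s Fin.≟ i
    -- Coordinate `i` is 0, so lying on `x_i = 1` would force the modulus, which is at least 2, to
    -- divide 1.
    ... | yes refl = λ d → contradiction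
      (∣⇒∣ᵤ (subst (λ z → + Q ∣ z ℤ.- + 1) (trans (linForm-e x s) (cong +_ xi≡0)) d))
      (>⇒∤ (s≤s (s≤s z≤n)))
    ... | no s≢i = proj₂ (other s≢i) ∘ subst (λ z → + Q ∣ z ℤ.- + 1) (linForm-e x s)
    avoid : ∀ {H} → H ∈ removeH (e i , + 0) (shiB (suc r)) → ¬ (x ∈Hq H)
    avoid {H} H∈ with ∈-filter⁻ (λ H′ → ¬? (H′ ≟H (e i , + 0))) {xs = shiB (suc r)} H∈
    ... | H∈shi , H≢ with ∈-++⁻ (concatMap (λ s → (e s , + 0) ∷ (e s , + 1) ∷ []) (allFin (suc r))) H∈shi
    ... | inj₁ H∈₁ with find (∈-concatMap⁻ (λ s → (e s , + 0) ∷ (e s , + 1) ∷ []) {xs = allFin (suc r)} H∈₁)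
    ...   | s , _ , H∈s = single s H∈s H≢
    avoid {H} H∈ | H∈shi , H≢ | inj₂ H∈₂ with find (∈-concatMap⁻ _ {xs = allFin (suc r)} H∈₂)
    ...   | s , _ , H∈s with find (∈-concatMap⁻ _ {xs = filter (s <F?_) (allFin (suc r))} H∈s)
    ...     | t , t∈ , H∈pair =
      apart⇒∉ {x = x} (apart (proj₂ (∈-filter⁻ (s <F?_) {xs = allFin (suc r)} t∈))) H∈pair

  -- None of the hyperplanes with two coordinates equals `x_i = 0`, so all of them survive its
  -- removal, and avoiding them yields separation.
  restricted⇒valid : ∀ {q r} (i : Fin (suc r)) (x : Point (suc (suc q)) (suc r)) →
    Restricted i x → valid (schedule i) ∅ x ≡ true
  restricted⇒valid {q} {r} i x (avoid , x∈H) = valid-complete (schedule i) ∅ x ((λ _ → refl) , pinned , sep)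
    where
    Q = suc (suc q)
    pinned : ∀ s → lookup (schedule i) s ≡ true → coord x s ≡ 0
    pinned s eq with lookup-schedule⁻ i s eq
    ... | refl = ∣⇒≡0 (toℕ<n _) (subst (+ Q ∣_) (trans (ℤ.+-identityʳ _) (linForm-e x i)) x∈H)
    pair-≢ : ∀ {s t H} → s Fin.< t → H ∈ pairH s t → H ≢ (e i , + 0)
    pair-≢ s<t (here refl)                         = pair-vector-≢ ℤ._+_ (λ ()) (λ ()) i s<t
    pair-≢ s<t (there (here refl))                 = pair-vector-≢ ℤ._+_ (λ ()) (λ ()) i s<t
    pair-≢ s<t (there (there (here refl)))         = pair-vector-≢ ℤ._-_ (λ ()) (λ ()) i s<t
    pair-≢ s<t (there (there (there (here refl)))) = pair-vector-≢ ℤ._-_ (λ ()) (λ ()) i s<t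
    sep : ∀ s t → s Fin.< t → Separated Q (coord x s) (coord x t)
    sep s t s<t = Equivalence.from (separated⇔apart (toℕ<n _) (toℕ<n _)) (∉⇒apart {x = x} λ H∈ →
      All.lookup avoid (∈-filter⁺ (λ H′ → ¬? (H′ ≟H (e i , + 0))) (pair-∈ s<t H∈) (pair-≢ s<t H∈)))

  -- Parity of q and the passage to integers.

  half : ∀ d → Σ[ odd ∈ Bool ] ∃ λ h → d ≡ 2 * h + bit odd
  half 0 = false , 0 , refl
  half 1 = true , 0 , refl
  half (suc (suc d)) with half d
  ... | odd , h , refl = odd , suc h , double h (bit odd)
    where
    double : ∀ h b → suc (suc (2 * h + b)) ≡ 2 * suc h + b
    double = solve-∀

  -- Taking `n = r + h` gives the `r` free coordinates the surplus `h`. The modulus is then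
  -- `2 * suc r + (2 * h + bit odd)`, so both bases are `q - 2m` plus a constant.
  countRestriction-modulus : ∀ odd h {r} (i : Fin (suc r)) →
    countRestriction (suc r) (modulus odd (r + h)) (e i , + 0)
      ≡ (2 * h + bit odd + 1) ^ (r ∸ toℕ i) * (2 * h + bit odd + 2) ^ toℕ i
  countRestriction-modulus odd h {r} i = begin
    countRestriction (suc r) q (e i , + 0)
      ≡⟨ length-filter-filter
           (λ x → All.all? (λ H′ → ¬? (x ∈Hq? H′)) (removeH (e i , + 0) (shiB (suc r))))
           (λ x → x ∈Hq? (e i , + 0)) (valid (schedule i) ∅)
           (λ x → mk⇔ (valid⇒restricted i x) (restricted⇒valid i x)) (allPoints q (suc r)) ⟩
    tally (valid (schedule i) ∅) (allPoints q (suc r))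
      ≡⟨ tally-valid _ (schedule i) ∅ ⟩
    placements (residueSum q) (schedule i) ∅
      ≡⟨ placements-residues odd (r + h) i ∅ ⟩
    placements (edgeSum odd (r + h)) (schedule i) ∅
      ≡⟨ placements-schedule odd h i ⟩
    (2 * h + bit odd + 1) ^ (r ∸ toℕ i) * (2 * h + bit odd + 2) ^ toℕ i ∎
    where
    open ≡-Reasoning
    q = modulus odd (r + h)

  modulus-excess : ∀ odd h r → modulus odd (r + h) ≡ 2 * suc r + (2 * h + bit odd)
  modulus-excess odd h r = excess r h (bit odd)
    where
    excess : ∀ r h b → suc (suc (r + h) + (r + h + b)) ≡ 2 * suc r + (2 * h + b)
    excess = solve-∀

  pos-^ : ∀ a n → + (a ^ n) ≡ (+ a) ℤ.^ n
  pos-^ a zero    = refl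
  pos-^ a (suc n) = trans (ℤ.pos-* a (a ^ n)) (cong ((+ a) ℤ.*_) (pos-^ a n))

  countRestriction-excess : ∀ r d (i : Fin (suc r)) →
    countRestriction (suc r) (2 * suc r + d) (e i , + 0) ≡ (d + 1) ^ (r ∸ toℕ i) * (d + 2) ^ toℕ i
  countRestriction-excess r d i with half d
  ... | odd , h , refl = trans
    (cong (λ q → countRestriction (suc r) q (e i , + 0)) (sym (modulus-excess odd h r)))
    (countRestriction-modulus odd h i)

  excess-∸ : ∀ m d c → + (2 * m + d) ℤ.- + (2 * m) ℤ.+ + c ≡ + (d + c)
  excess-∸ m d c = cancel (+ (2 * m)) (+ d) (+ c)
    where
    cancel : ∀ m d c → m ℤ.+ d ℤ.- m ℤ.+ c ≡ d ℤ.+ c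
    cancel = ℤ-Solver.solve-∀

  count-in-ℤ : ∀ r d (i : Fin (suc r)) →
    + countRestriction (suc r) (2 * suc r + d) (e i , + 0)
      ≡ (+ (2 * suc r + d) ℤ.- + (2 * suc r) ℤ.+ + 1) ℤ.^ (r ∸ toℕ i)
        ℤ.* (+ (2 * suc r + d) ℤ.- + (2 * suc r) ℤ.+ + 2) ℤ.^ toℕ i
  count-in-ℤ r d i = begin
    + countRestriction (suc r) (2 * suc r + d) (e i , + 0)
      ≡⟨ cong +_ (countRestriction-excess r d i) ⟩
    + ((d + 1) ^ (r ∸ toℕ i) * (d + 2) ^ toℕ i)
      ≡⟨ ℤ.pos-* ((d + 1) ^ (r ∸ toℕ i)) _ ⟩
    + ((d + 1) ^ (r ∸ toℕ i)) ℤ.* + ((d + 2) ^ toℕ i)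
      ≡⟨ cong₂ ℤ._*_ (pos-^ (d + 1) (r ∸ toℕ i)) (pos-^ (d + 2) (toℕ i)) ⟩
    (+ (d + 1)) ℤ.^ (r ∸ toℕ i) ℤ.* (+ (d + 2)) ℤ.^ toℕ i
      ≡⟨ cong₂ (λ a b → a ℤ.^ (r ∸ toℕ i) ℤ.* b ℤ.^ toℕ i) (excess-∸ (suc r) d 1) (excess-∸ (suc r) d 2) ⟨
    (+ (2 * suc r + d) ℤ.- + (2 * suc r) ℤ.+ + 1) ℤ.^ (r ∸ toℕ i)
      ℤ.* (+ (2 * suc r + d) ℤ.- + (2 * suc r) ℤ.+ + 2) ℤ.^ toℕ i ∎
    where open ≡-Reasoning

open Hyperplanes using (count-in-ℤ)
open import Data.Nat using (ℕ; suc; _≤_; _∸_) renaming (_*_ to _*ℕ_)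
open import Data.Nat.Properties using (m+[n∸m]≡n)
open import Data.Integer using (ℤ; +_; _+_; _-_; _*_; _^_)
open import Data.Fin using (Fin; toℕ)

theorem3p1 : (m : ℕ) → (i : Fin m) →
    ∃ λ N → (q : ℕ) → 1 ≤ q → N ≤ q →
    + countRestriction m q (e i , + 0)
    ≡ ((+ q - + (2 *ℕ m) + + 1) ^ (m ∸ suc (toℕ i)))
    * ((+ q - + (2 *ℕ m) + + 2) ^ toℕ i)
-- The bound is `2m`: from there on `q - 2m` is a natural number, which serves as the excess `d` in
-- `count-in-ℤ`.
theorem3p1 (suc r) i = 2 *ℕ suc r , λ q _ 2m≤q →
  subst
    (λ q → + countRestriction (suc r) q (e i , + 0)
      ≡ ((+ q - + (2 *ℕ suc r) + + 1) ^ (r ∸ toℕ i)) * ((+ q - + (2 *ℕ suc r) + + 2) ^ toℕ i))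
    (m+[n∸m]≡n 2m≤q) (count-in-ℤ r (q ∸ 2 *ℕ suc r) i)
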